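{- Let $n\geq 4$ be an integer. The number of pairwise nonisomorphic $3$-minimal trees with $n$ vertices equals: - $1$ if $n\in\{4,5\}$; - $2$ if $n=6$; - $\left[\frac{(n-1)^2}{12}\right]-\left\lfloor\frac{n-4}{2}\right\rfloor+\left\lfloor\frac{n-2}{2}\right\rfloor-1$ if $n\ge 7$, where $[x]$ denotes the nearest integer to $x$.
   Context: Graphs are finite, simple and undirected. For a graph $G=(V,E)$, a module of $G$ is a subset $M\subseteq V$ such that every vertex outside $M$ is adjacent to all or to none of the vertices of $M$. The modules $\emptyset$, $\{x\}$ ($x\in V$) and $V$ are trivial. $G$ is prime if it has at least four vertices and all its modules are trivial. For a vertex subset $X$, a prime graph $G$ is minimal for $X$ if no proper induced subgraph of $G$ containing $X$ is prime. A graph is $k$-minimal if it is (prime and) minimal for some set of exactly $k$ of its vertices. -}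

module Defs where

open import Data.Bool using (Bool; T)
open import Data.Fin using (Fin; zero; suc; inject₁; fromℕ)
open import Data.Fin.Permutation
  using (Permutation; _⟨$⟩ʳ_; _⟨$⟩ˡ_; inverseʳ)
import Data.Fin.Permutation as Perm
open import Data.Fin.Properties using (suc-injective)
open import Data.Fin.Subset
  using (Subset; inside; outside; _∈_; _∉_; _⊆_; _⊂_; ∣_∣; ⁅_⁆; ⊤)
  renaming (⊥ to ∅)
open import Data.Nat using (ℕ; zero; suc; _+_; _≤_; _<_)
open import Data.Product using (Σ; ∃; _×_; _,_; proj₁)
open import Data.Sum using (_⊎_)
open import Data.Vec using (_∷_; here; there)
open import Function.Bundles using (Bijection)
open import Function.Definitions using (Injective)
open import Level using (0ℓ)
open import Relation.Binary.Bundles using (Setoid)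
open import Relation.Binary.Construct.Closure.ReflexiveTransitive using (Star)
import Relation.Binary.Construct.On as On
open import Relation.Binary.Core using (Rel)
open import Relation.Binary.Definitions using (Symmetric)
open import Relation.Binary.PropositionalEquality
  using (_≡_; refl; sym; trans; cong; cong₂; setoid)
open import Relation.Nullary using (¬_)

record Graph (n : ℕ) : Set where
  field
    adj : Fin n → Fin n → Bool

  infix 4 _~_
  _~_ : Rel (Fin n) 0ℓ
  u ~ v = T (adj u v)

  field
    ~-sym    : Symmetric _~_
    ~-irrefl : ∀ v → ¬ v ~ v

-- The elements of S listed in increasing order; used to renumber the
-- vertices of an induced subgraph by Fin ∣ S ∣.
enum : ∀ {n} (S : Subset n) → Fin ∣ S ∣ → Fin n
enum (inside  ∷ S) zero    = zero
enum (inside  ∷ S) (suc i) = suc (enum S i)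
enum (outside ∷ S) i       = suc (enum S i)

enum-∈ : ∀ {n} (S : Subset n) i → enum S i ∈ S
enum-∈ (inside  ∷ S) zero    = here
enum-∈ (inside  ∷ S) (suc i) = there (enum-∈ S i)
enum-∈ (outside ∷ S) i       = there (enum-∈ S i)

enum-injective : ∀ {n} (S : Subset n) → Injective _≡_ _≡_ (enum S)
enum-injective (inside  ∷ S) {zero}  {zero}  _  = refl
enum-injective (inside  ∷ S) {suc i} {suc j} eq =
  cong suc (enum-injective S (suc-injective eq))
enum-injective (outside ∷ S) eq = enum-injective S (suc-injective eq)

enum-surjective : ∀ {n} (S : Subset n) {v} → v ∈ S → ∃ λ i → enum S i ≡ v
enum-surjective (inside ∷ S) here = zero , refl
enum-surjective (inside ∷ S) (there v∈S) with enum-surjective S v∈S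
... | i , eq = suc i , cong suc eq
enum-surjective (outside ∷ S) (there v∈S) with enum-surjective S v∈S
... | i , eq = i , cong suc eq

infix 8 _[[_]]
_[[_]] : ∀ {n} → Graph n → (S : Subset n) → Graph ∣ S ∣
G [[ S ]] = record
  { adj      = λ i j → Graph.adj G (enum S i) (enum S j)
  ; ~-sym    = Graph.~-sym G
  ; ~-irrefl = λ i → Graph.~-irrefl G (enum S i)
  }

module _ {n : ℕ} (G : Graph n) where
  open Graph G

  IsModule : Subset n → Set
  IsModule M = ∀ v → v ∉ M →
    (∀ x → x ∈ M → v ~ x) ⊎ (∀ x → x ∈ M → ¬ v ~ x)

  IsTrivial : Subset n → Set
  IsTrivial M = M ≡ ∅ ⊎ (∃ λ x → M ≡ ⁅ x ⁆) ⊎ M ≡ ⊤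

  IsPrime : Set
  IsPrime = 4 ≤ n × (∀ M → IsModule M → IsTrivial M)

  IsConnected : Set
  IsConnected = ∀ u v → Star _~_ u v

  -- A cycle has 3 + k pairwise distinct vertices c 0, …, c (2 + k).
  HasCycle : Set
  HasCycle = ∃ λ k → Σ (Fin (3 + k) → Fin n) λ c →
    Injective _≡_ _≡_ c ×
    (∀ i → c (inject₁ i) ~ c (suc i)) ×
    c (fromℕ (2 + k)) ~ c zero

  IsTree : Set
  IsTree = 0 < n × IsConnected × ¬ HasCycle

IsMinimalFor : ∀ {n} → Graph n → Subset n → Set
IsMinimalFor G X = IsPrime G × (∀ S → X ⊆ S → S ⊂ ⊤ → ¬ IsPrime (G [[ S ]]))

IsMinimal : ℕ → ∀ {n} → Graph n → Set
IsMinimal k G = ∃ λ X → ∣ X ∣ ≡ k × IsMinimalFor G X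

infix 4 _≅_
_≅_ : ∀ {m n} → Graph m → Graph n → Set
_≅_ {m} {n} G H = Σ (Permutation m n) λ π →
  ∀ u v → Graph.adj G u v ≡ Graph.adj H (π ⟨$⟩ʳ u) (π ⟨$⟩ʳ v)

≅-refl : ∀ {n} {G : Graph n} → G ≅ G
≅-refl = Perm.id , λ _ _ → refl

≅-sym : ∀ {m n} {G : Graph m} {H : Graph n} → G ≅ H → H ≅ G
≅-sym {H = H} (π , p) = Perm.flip π , λ u v →
  sym (trans (p (π ⟨$⟩ˡ u) (π ⟨$⟩ˡ v))
             (cong₂ (Graph.adj H) (inverseʳ π) (inverseʳ π)))

≅-trans : ∀ {l m n} {G : Graph l} {H : Graph m} {K : Graph n} →
          G ≅ H → H ≅ K → G ≅ K
≅-trans (π , p) (ρ , q) =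
  π Perm.∘ₚ ρ , λ u v → trans (p u v) (q (π ⟨$⟩ʳ u) (π ⟨$⟩ʳ v))

graphSetoid : ℕ → Setoid 0ℓ 0ℓ
graphSetoid n = record
  { Carrier       = Graph n
  ; _≈_           = _≅_
  ; isEquivalence = record
    { refl  = λ {G} → ≅-refl {G = G}
    ; sym   = λ {G} {H} → ≅-sym {G = G} {H}
    ; trans = λ {G} {H} {K} → ≅-trans {G = G} {H} {K}
    }
  }

-- Only the underlying graphs are compared, so the equivalence classes are
-- the isomorphism classes of k-minimal trees with n vertices.
minimalTrees : ℕ → ℕ → Setoid 0ℓ 0ℓ
minimalTrees k n =
  On.setoid {B = Σ (Graph n) λ G → IsTree G × IsMinimal k G}
            (graphSetoid n) proj₁

-- "S has exactly N equivalence classes": a bijection of setoids, i.e. a list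
-- of N pairwise inequivalent elements meeting every class.
HasClasses : Setoid 0ℓ 0ℓ → ℕ → Set
HasClasses S N = Bijection (setoid (Fin N)) S

-- A tree with at least four vertices is prime iff no two of its leaves have a
-- common neighbour.  If a prime tree G is minimal for X with ∣ X ∣ = 3, grow a
-- path between two elements of X and then a leg from it to the third one.
-- This gives a spider with at most three legs that contains X.  It need not be
-- prime, but as twin leaves do not form a module of G, one of them has a
-- further neighbour, which prolongs its leg.  The resulting prime spider is an
-- induced subgraph and hence all of G.  Conversely, paths and spiders without
-- twin leaves are minimal for any three vertices that include their leaves: an
-- induced subgraph that contains the leaves but misses a vertex is
-- disconnected.
--
-- The spiders with n vertices and three legs correspond to the partitions of
-- n - 1 into three parts; the only non-prime one, with legs 1, 1, n - 3, makes
-- up for the path.  A leg is recovered from the isomorphism class as a walk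
-- from the vertex of degree 3 to a leaf; the minimum and the maximum of the
-- lengths and their sum n - 1 determine all three.
module Submission where

open import Defs
open import Data.Bool using (Bool; true; false; T; if_then_else_; _∨_)
open import Data.Bool.Properties using (T?)
open import Data.Empty using (⊥; ⊥-elim)
open import Data.Fin using (Fin; zero; suc; toℕ; fromℕ; fromℕ<; inject₁; splitAt; _↑ˡ_; _↑ʳ_)
import Data.Fin as Fin
open import Data.Fin.Induction using (>-wellFounded; Acc; acc)
open import Data.Fin.Permutation
  using (permutation; _⟨$⟩ʳ_; _⟨$⟩ˡ_; inverseˡ; inverseʳ; ↔⇒≡)
open import Data.Fin.Properties
  using (toℕ-injective; toℕ<n; toℕ-inject₁; toℕ-fromℕ; toℕ-fromℕ<; any?; pigeonhole;
         splitAt-↑ˡ; splitAt-↑ʳ; splitAt⁻¹-↑ˡ; splitAt⁻¹-↑ʳ)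
  renaming (_≟_ to _≟F_)
open import Data.Fin.Relation.Unary.Top using (view; ‵fromℕ; ‵inject₁)
open import Data.Fin.Subset using (Subset; inside; outside; _∈_; _∉_; ∣_∣; ⁅_⁆; _∪_)
open import Data.Fin.Subset.Properties
open import Data.Nat
  using (ℕ; zero; suc; _+_; _*_; _∸_; _≤_; _<_; z≤n; s≤s; _≟_; _≡ᵇ_; _<?_; _≤?_; ⌊_/2⌋; ⌈_/2⌉)
import Data.Nat as ℕ
open import Data.Nat.Divisibility using (divides)
open import Data.Nat.DivMod using (m*n/n≡m; m<n⇒m/n≡0; +-distrib-/-∣ʳ; m/n≡1+[m∸n]/n)
open import Data.Nat.Induction using (<-rec)
open import Data.Nat.Properties
open import Data.Nat.Tactic.RingSolver using (solve-∀)
open import Data.Product using (Σ; ∃; ∃₂; _×_; _,_; proj₁; proj₂)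
open import Data.Sum using (_⊎_; inj₁; inj₂; [_,_]′)
open import Data.Vec using (_∷_; here; there; tabulate)
open import Data.Vec.Properties using (lookup∘tabulate; []=⇒lookup; lookup⇒[]=)
open import Function using (_∘_; id; case_of_)
open import Level using (0ℓ)
open import Relation.Binary.Construct.Closure.ReflexiveTransitive using (Star; ε; _◅_; _◅◅_; reverse)
open import Relation.Binary.Core using (Rel)
open import Relation.Binary.Definitions using (Symmetric; DecidableEquality; tri<; tri≈; tri>)
open import Relation.Binary.PropositionalEquality
open import Relation.Nullary using (¬_; Dec; yes; no; contradiction)
open import Relation.Nullary.Decidable using (_×-dec_; _⊎-dec_; ¬?; decidable-stable; does; dec-true)
open import Relation.Unary using (Pred; Decidable)

-- Embeddings of rooted trees, and loop erasure.

-- Rooted trees on initial segments of ℕ: the parent of suc w is P w, and 0 is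
-- the root.
Decreasing : (ℕ → ℕ) → Set
Decreasing P = ∀ w → P w ≤ w

-- Edges run from a child to its parent. Non-edges are not recorded: in an acyclic graph they come
-- for free, by `embeds-reflects`. Values of `f` at or beyond `k` carry no meaning.
record Embeds {A : Set} (R : Rel A 0ℓ) (P : ℕ → ℕ) (k : ℕ) (f : ℕ → A) : Set where
  field
    injective : ∀ {i j} → i < k → j < k → f i ≡ f j → i ≡ j
    edge      : ∀ {w} → suc w < k → R (f (suc w)) (f (P w))

open Embeds

_[_↦_] : {A : Set} → (ℕ → A) → ℕ → A → ℕ → A
(f [ k ↦ v ]) j with j ≟ k
... | yes _ = v
... | no  _ = f j

update-≡ : {A : Set} (f : ℕ → A) (k : ℕ) (v : A) → (f [ k ↦ v ]) k ≡ v
update-≡ f k v with k ≟ k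
... | yes _   = refl
... | no  k≢k = contradiction refl k≢k

update-< : {A : Set} (f : ℕ → A) {k : ℕ} (v : A) {j : ℕ} → j < k → (f [ k ↦ v ]) j ≡ f j
update-< f {k} v {j} j<k with j ≟ k
... | yes refl = contradiction j<k (<-irrefl refl)
... | no  _    = refl

module _ {A : Set} {R : Rel A 0ℓ} where

  truncate : ∀ {P k l f} → l ≤ k → Embeds R P k f → Embeds R P l f
  truncate l≤k e .injective i<l j<l = e .injective (≤-trans i<l l≤k) (≤-trans j<l l≤k)
  truncate l≤k e .edge w<l = e .edge (≤-trans w<l l≤k)

  reparent : ∀ {P Q k f} → (∀ {w} → suc w < k → P w ≡ Q w) → Embeds R P k f → Embeds R Q k f
  reparent P≗Q e .injective = e .injective
  reparent {f = f} P≗Q e .edge w<k =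
    subst (λ p → R (f (suc _)) (f p)) (P≗Q w<k) (e .edge w<k)

  -- The vertex takes the next free label. As parents are smaller, all earlier edges lie among
  -- labels that the update leaves alone.
  grow : ∀ {P w f v} → Decreasing P → Embeds R P (suc w) f →
         (∀ {j} → j ≤ w → f j ≢ v) → R v (f (P w)) →
         Embeds R P (suc (suc w)) (f [ suc w ↦ v ])
  grow {P} {w} {f} {v} P≤ e v∉ r .injective {i} {j} i< j< eq
    with m≤n⇒m<n∨m≡n (≤-pred i<) | m≤n⇒m<n∨m≡n (≤-pred j<)
  ... | inj₁ i≤ | inj₁ j≤ = e .injective i≤ j≤
    (trans (sym (update-< f v i≤)) (trans eq (update-< f v j≤)))
  ... | inj₁ i≤ | inj₂ refl = contradiction
    (trans (sym (update-< f v i≤)) (trans eq (update-≡ f (suc w) v))) (v∉ (≤-pred i≤))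
  ... | inj₂ refl | inj₁ j≤ = contradiction
    (trans (sym (update-< f v j≤)) (trans (sym eq) (update-≡ f (suc w) v))) (v∉ (≤-pred j≤))
  ... | inj₂ refl | inj₂ refl = refl
  grow {P} {w} {f} {v} P≤ e v∉ r .edge {u} u< with m≤n⇒m<n∨m≡n (≤-pred u<)
  ... | inj₁ u≤ = subst₂ R (sym (update-< f v u≤))
                    (sym (update-< f v (≤-trans (s≤s (P≤ u)) (<⇒≤ u≤)))) (e .edge u≤)
  ... | inj₂ refl = subst₂ R (sym (update-≡ f (suc w) v)) (sym (update-< f v (s≤s (P≤ u)))) r

-- The spider with legs a, b, c: labels 0, …, m form a path with centre a,
-- where m = a + b, and the third leg starts at suc m.
spider : ℕ → ℕ → ℕ → ℕ
spider a m w = if w ≡ᵇ m then a else w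

spider-≡ : ∀ a m → spider a m m ≡ a
spider-≡ a m with m ≡ᵇ m in eq
... | true  = refl
... | false = contradiction (≡⇒≡ᵇ m m refl) (subst (¬_ ∘ T) (sym eq) id)

spider-≢ : ∀ a {m w} → w ≢ m → spider a m w ≡ w
spider-≢ a {m} {w} w≢m with w ≡ᵇ m in eq
... | true  = contradiction (≡ᵇ⇒≡ w m (subst T (sym eq) _)) w≢m
... | false = refl

spider-decreasing : ∀ {a m} → a ≤ m → Decreasing (spider a m)
spider-decreasing {a} {m} a≤m w with w ≟ m
... | yes refl = ≤-trans (≤-reflexive (spider-≡ a m)) a≤m
... | no  w≢m  = ≤-reflexive (spider-≢ a w≢m)

Image : {A : Set} → ℕ → (ℕ → A) → A → Set
Image k f v = ∃ λ j → j < k × f j ≡ v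

module _ {A : Set} (_≟A_ : DecidableEquality A) where

  image? : ∀ k (f : ℕ → A) v → Dec (Image k f v)
  image? zero    f v = no λ ()
  image? (suc k) f v with f k ≟A v
  ... | yes eq = yes (k , ≤-refl , eq)
  ... | no neq with image? k f v
  ...   | yes (j , j<k , eq) = yes (j , ≤-trans j<k (n≤1+n k) , eq)
  ...   | no ∉ = no λ (j , j<k , eq) → case m≤n⇒m<n∨m≡n (≤-pred j<k) of λ where
            (inj₁ j<k) → ∉ (j , j<k , eq)
            (inj₂ refl) → neq eq

module _ {A : Set} (_≟A_ : DecidableEquality A) {R : Rel A 0ℓ} where

  -- `a` is the label where the new leg leaves the path, and `suc c` is its length, so the leg is
  -- never empty. If `a` is 0 or `m`, the leg merely prolongs the path.
  record Attached (m : ℕ) (f : ℕ → A) (v : A) : Set where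
    field
      a c     : ℕ
      g       : ℕ → A
      a≤m     : a ≤ m
      embeds  : Embeds R (spider a m) (suc (m + suc c)) g
      extends : ∀ {j} → j ≤ m → g j ≡ f j
      end     : g (m + suc c) ≡ v

  -- Following a walk back from v to the path f, a step revisiting the new
  -- leg truncates it: this is loop erasure.
  attach : ∀ {m f v j} → Embeds R id (suc m) f → Star R v (f j) → j ≤ m →
           Image (suc m) f v ⊎ Attached m f v
  attach {j = j} e ε j≤m = inj₁ (j , s≤s j≤m , refl)
  attach {m} {f} {v} e (_◅_ {j = u} r walk) j≤m with image? _≟A_ (suc m) f v | attach e walk j≤m
  ... | yes v∈ | _ = inj₁ v∈
  ... | no v∉  | inj₁ (a , a≤m , refl) = inj₂ record
    { a = a ; c = 0 ; g = f [ suc m ↦ v ] ; a≤m = ≤-pred a≤m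
    ; embeds = subst (λ k → Embeds R (spider a m) (suc k) (f [ suc m ↦ v ])) (+-comm 1 m)
        (grow (spider-decreasing (≤-pred a≤m))
          (reparent (λ w<m → sym (spider-≢ a (<⇒≢ (≤-pred w<m)))) e)
          (λ j≤m eq → v∉ (_ , s≤s j≤m , eq))
          (subst (R v ∘ f) (sym (spider-≡ a m)) r))
    ; extends = λ j≤m → update-< f v (s≤s j≤m)
    ; end = trans (cong (f [ suc m ↦ v ]) (+-comm m 1)) (update-≡ f (suc m) v)
    }
  ... | no v∉  | inj₂ att with image? _≟A_ (suc (m + suc (Attached.c att))) (Attached.g att) v
  ...   | yes (j , j< , eq) = inj₂ record
    { a = a ; c = j ∸ suc m ; g = g ; a≤m = a≤m
    ; embeds = truncate (≤-trans (≤-reflexive (cong suc lemma)) j<) embeds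
    ; extends = extends
    ; end = trans (cong g lemma) eq
    }
    where
    open Attached att
    m<j : m < j
    m<j = ≰⇒> λ j≤m → v∉ (j , s≤s j≤m , trans (sym (extends j≤m)) eq)
    lemma : m + suc (j ∸ suc m) ≡ j
    lemma = trans (+-suc m _) (m+[n∸m]≡n m<j)
  ...   | no v∉′ = inj₂ record
    { a = a ; c = suc c ; g = g [ suc l ↦ v ] ; a≤m = a≤m
    ; embeds = subst (λ k → Embeds R (spider a m) (suc k) (g [ suc l ↦ v ])) (sym (+-suc m (suc c)))
        (grow (spider-decreasing a≤m) embeds
          (λ j≤ eq → v∉′ (_ , s≤s j≤ , eq))
          -- The old end of the leg has a label above `m`, so the next label hangs on it and not on
          -- `a`.
          (subst (R v) (sym (trans (cong g (spider-≢ a (>⇒≢ (m<m+n m (s≤s z≤n))))) end)) r))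
    ; extends = λ j≤m → trans (update-< g v (s≤s (≤-trans j≤m (m≤m+n m (suc c))))) (extends j≤m)
    ; end = trans (cong (g [ suc l ↦ v ]) (+-suc m (suc c))) (update-≡ g (suc l) v)
    }
    where
    open Attached att
    l : ℕ
    l = m + suc c

  -- This is `attach` for the path with the single vertex `s`: the attachment label can only be 0,
  -- and `spider 0 0` is pointwise the identity.
  path : ∀ {s v} → Star R v s → v ≢ s →
         ∃₂ λ m f → Embeds R id (suc (suc m)) f × f 0 ≡ s × f (suc m) ≡ v
  path {s} {v} walk v≢s with attach {m = 0} {f = λ _ → s} {j = 0} point walk z≤n
    where
    point : Embeds R id 1 (λ _ → s)
    point .injective (s≤s z≤n) (s≤s z≤n) _ = refl
    point .edge (s≤s ())
  ... | inj₁ (_ , _ , eq) = contradiction (sym eq) v≢s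
  ... | inj₂ att with Attached.a≤m att
  ...   | z≤n = c , g , reparent (λ {w} _ → lemma w) embeds , extends z≤n , end
    where
    open Attached att
    lemma : ∀ w → spider 0 0 w ≡ w
    lemma zero    = refl
    lemma (suc w) = refl

-- Trees labelled by parent functions, embedded in acyclic graphs

child : (ℕ → ℕ) → ℕ → ℕ → Bool
child P zero    j = false
child P (suc w) j = P w ≡ᵇ j

Child : (ℕ → ℕ) → Rel ℕ 0ℓ
Child P i j = T (child P i j)

-- Adjacency in `treeGraph` unfolds to this at `toℕ u` and `toℕ v`, so facts about labels in ℕ apply
-- without conversion.
Adjacent : (ℕ → ℕ) → Rel ℕ 0ℓ
Adjacent P i j = T (child P i j ∨ child P j i)

module _ {P : ℕ → ℕ} where

  child⁺ : ∀ w → Child P (suc w) (P w)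
  child⁺ w = ≡⇒≡ᵇ (P w) (P w) refl

  child⁻ : ∀ {w j} → Child P (suc w) j → P w ≡ j
  child⁻ {w} {j} = ≡ᵇ⇒≡ (P w) j

  child-< : Decreasing P → ∀ {i j} → Child P i j → j < i
  child-< P≤ {suc w} c = s≤s (subst (_≤ w) (child⁻ c) (P≤ w))

  adjacent⁻ : ∀ {i j} → Adjacent P i j → Child P i j ⊎ Child P j i
  adjacent⁻ {i} {j} with child P i j
  ... | true  = λ _ → inj₁ _
  ... | false = inj₂

  adjacentˡ : ∀ {i j} → Child P i j → Adjacent P i j
  adjacentˡ {i} {j} c with child P i j
  ... | true = _

  adjacentʳ : ∀ {i j} → Child P j i → Adjacent P i j
  adjacentʳ {i} {j} c with child P i j
  ... | true  = _
  ... | false = c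

  adjacent-sym : ∀ {i j} → Adjacent P i j → Adjacent P j i
  adjacent-sym {i} {j} a with adjacent⁻ {i} {j} a
  ... | inj₁ c = adjacentʳ {j} {i} c
  ... | inj₂ c = adjacentˡ {j} {i} c

spider-step : ∀ a {m w} → w ≢ m → Child (spider a m) (suc w) w
spider-step a {m} {w} w≢m =
  subst (Child (spider a m) (suc w)) (spider-≢ a w≢m) (child⁺ {spider a m} w)

spider-branch : ∀ a m → Child (spider a m) (suc m) a
spider-branch a m = subst (Child (spider a m) (suc m)) (spider-≡ a m) (child⁺ {spider a m} m)

treeGraph : (P : ℕ → ℕ) → Decreasing P → ∀ n → Graph n
treeGraph P P≤ n = record
  { adj      = λ u v → child P (toℕ u) (toℕ v) ∨ child P (toℕ v) (toℕ u)
  ; ~-sym    = λ {u} {v} → adjacent-sym {P} {toℕ u} {toℕ v}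
  ; ~-irrefl = λ v v~v → [ irrefl (toℕ v) , irrefl (toℕ v) ]′ (adjacent⁻ {P} {toℕ v} {toℕ v} v~v)
  }
  where
  irrefl : ∀ i → ¬ Child P i i
  irrefl i c = <-irrefl refl (child-< P≤ {i} c)

module _ {n : ℕ} (G : Graph n) where
  open Graph G

  Avoiding : Fin n → Rel (Fin n) 0ℓ
  Avoiding v u w = u ~ w × u ≢ v × w ≢ v

  avoiding-sym : ∀ {v} → Symmetric (Avoiding v)
  avoiding-sym (u~w , u≢v , w≢v) = ~-sym u~w , w≢v , u≢v

  -- Otherwise loop erasure turns the walk into a path that avoids `v`, and `v` closes it to a
  -- cycle.
  unique-neighbour : ¬ HasCycle G → ∀ {v s t} → v ~ s → v ~ t →
                     Star (Avoiding v) t s → t ≡ s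
  unique-neighbour acyclic {v} {s} {t} v~s v~t walk with t ≟F s
  ... | yes t≡s = t≡s
  ... | no  t≢s with path _≟F_ walk t≢s
  ...   | m , f , e , f0 , fm = contradiction (m , c , (λ {i} {j} → c-injective {i} {j}) , c-edge , c-closed) acyclic
    where
    c : Fin (3 + m) → Fin n
    c zero    = v
    c (suc i) = f (toℕ i)

    -- The first path vertex is `s`, a neighbour of `v`; every later one is the source of an edge of
    -- `Avoiding v`.
    v≢f : ∀ (i : Fin (2 + m)) → v ≢ f (toℕ i)
    v≢f zero    refl = ~-irrefl v (subst (v ~_) (sym f0) v~s)
    v≢f (suc i) refl = proj₁ (proj₂ (e .edge (toℕ<n (suc i)))) refl

    c-injective : ∀ {i j} → c i ≡ c j → i ≡ j
    c-injective {zero}  {zero}  eq = refl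
    c-injective {zero}  {suc j} eq = contradiction eq (v≢f j)
    c-injective {suc i} {zero}  eq = contradiction (sym eq) (v≢f i)
    c-injective {suc i} {suc j} eq =
      cong suc (toℕ-injective (e .injective (toℕ<n i) (toℕ<n j) eq))

    c-edge : ∀ i → c (inject₁ i) ~ c (suc i)
    c-edge zero    = subst (v ~_) (sym f0) v~s
    c-edge (suc i) = subst (λ j → f j ~ f (suc (toℕ i))) (sym (toℕ-inject₁ i))
      (~-sym (proj₁ (e .edge (toℕ<n (suc i)))))

    c-closed : c (fromℕ (2 + m)) ~ v
    c-closed = subst (_~ v) (sym (trans (cong f (toℕ-fromℕ (suc m))) fm)) (~-sym v~t)

  module _ {P : ℕ → ℕ} (P≤ : Decreasing P) {k : ℕ} {f : ℕ → Fin n}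
           (acyclic : ¬ HasCycle G) (e : Embeds _~_ P k f) where

    -- A neighbour of f i other than its parent, among the earlier vertices,
    -- would close a cycle.
    embeds-child : ∀ {i j} → i < k → j < i → f i ~ f j → Child P i j
    embeds-child {suc w} {j} i<k j<i i~j =
      ≡⇒≡ᵇ (P w) j (sym (e .injective (<-trans j<i i<k) (≤-trans (s≤s (P≤ w)) (<⇒≤ i<k))
        (unique-neighbour acyclic (e .edge i<k) i~j
          (toRoot j j<i ◅◅ reverse avoiding-sym (toRoot (P w) (s≤s (P≤ w)))))))
      where
      avoid : ∀ {x} → x < suc w → f x ≢ f (suc w)
      avoid x<i eq = <⇒≢ x<i (e .injective (<-trans x<i i<k) i<k eq)
      -- Parents are smaller, so the descent to the root stays below `suc w` and avoids its vertex.
      toRoot : ∀ x → x < suc w → Star (Avoiding (f (suc w))) (f x) (f 0)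
      toRoot = <-rec _ λ where
        zero    _   _   → ε
        (suc y) rec x<i →
          (e .edge (<-trans x<i i<k) , avoid x<i , avoid (≤-trans (s≤s (P≤ y)) (<⇒≤ x<i)))
          ◅ rec (s≤s (P≤ y)) (≤-trans (s≤s (P≤ y)) (<⇒≤ x<i))

    -- An embedding into an acyclic graph has no chords, so its image induces exactly the tree.
    embeds-reflects : ∀ {i j} → i < k → j < k → f i ~ f j → Adjacent P i j
    embeds-reflects {i} {j} i<k j<k i~j with <-cmp i j
    ... | tri< i<j _ _  = adjacentʳ {P} {i} {j} (embeds-child j<k i<j (~-sym i~j))
    ... | tri≈ _ refl _ = contradiction i~j (~-irrefl (f i))
    ... | tri> _ _ j<i  = adjacentˡ {P} {i} {j} (embeds-child i<k j<i i~j)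

  embeds-edge : ∀ {P k f} → Embeds _~_ P k f → ∀ {i j} → i < k → Child P i j → f i ~ f j
  embeds-edge {P} {f = f} e {suc w} i<k c =
    subst (λ p → f (suc w) ~ f p) (child⁻ {P} c) (e .edge i<k)

  embeds-preserves : ∀ {P k f} → Embeds _~_ P k f → ∀ {i j} → i < k → j < k →
                     Adjacent P i j → f i ~ f j
  embeds-preserves {P} {k} {f} e {i} {j} i<k j<k a with adjacent⁻ {P} {i} {j} a
  ... | inj₁ c = embeds-edge e i<k c
  ... | inj₂ c = ~-sym (embeds-edge e j<k c)

  -- Modules and twin leaves.

  -- Primality without the size condition, in a form that avoids equality of subsets and so
  -- transfers easily along isomorphisms.
  Indecomposable : Set
  Indecomposable = ∀ M → IsModule G M → ∀ {x y z} → x ∈ M → y ∈ M → z ∉ M → x ≡ y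

  prime⇒indecomposable : IsPrime G → Indecomposable
  prime⇒indecomposable (_ , trivial) M M-module {x} {y} {z} x∈M y∈M z∉M with trivial M M-module
  ... | inj₁ refl              = contradiction x∈M ∉⊥
  ... | inj₂ (inj₁ (w , refl)) = trans (x∈⁅y⁆⇒x≡y w x∈M) (sym (x∈⁅y⁆⇒x≡y w y∈M))
  ... | inj₂ (inj₂ refl)       = contradiction ∈⊤ z∉M

  indecomposable⇒trivial : Indecomposable → ∀ M → IsModule G M → IsTrivial G M
  indecomposable⇒trivial indec M M-module with nonempty? M
  ... | no  empty = inj₁ (Empty-unique empty)
  ... | yes (x , x∈M) with any? (λ z → ¬? (z ∈? M))
  ...   | no  full = inj₂ (inj₂ (⊆-antisym ⊆⊤
            λ {z} _ → decidable-stable (z ∈? M) λ z∉M → full (z , z∉M)))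
  ...   | yes (z , z∉M) = inj₂ (inj₁ (x , ⊆-antisym
            (λ y∈M → subst (_∈ ⁅ x ⁆) (indec M M-module x∈M y∈M z∉M) (x∈⁅x⁆ x))
            (λ y∈x → subst (_∈ M) (sym (x∈⁅y⁆⇒x≡y x y∈x)) x∈M)))

  NoTwinLeaves : Set
  NoTwinLeaves = ∀ {v x y} → v ~ x → v ~ y →
    (∀ {w} → w ~ x → w ≡ v) → (∀ {w} → w ~ y → w ≡ v) → x ≡ y

  boundary : ∀ M {z x} → Star _~_ z x → z ∉ M → x ∈ M → ∃₂ λ v u → v ∉ M × u ∈ M × v ~ u
  boundary M ε z∉M x∈M = contradiction x∈M z∉M
  boundary M (_◅_ {i = z} {j = w} z~w walk) z∉M x∈M with w ∈? M
  ... | yes w∈M = z , w , z∉M , w∈M , z~w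
  ... | no  w∉M = boundary M walk w∉M x∈M

  -- A vertex outside a nontrivial module M that is adjacent to M sees all of
  -- M; as there are no cycles of length 3 or 4, M consists of twin leaves.
  noTwinLeaves⇒indecomposable : IsConnected G → ¬ HasCycle G → NoTwinLeaves → Indecomposable
  noTwinLeaves⇒indecomposable connected acyclic twinFree M M-module {x} {y} {z} x∈M y∈M z∉M
    with x ≟F y
  ... | yes x≡y = x≡y
  ... | no  x≢y with boundary M (connected z x) z∉M x∈M
  ...   | v , u , v∉M , u∈M , v~u with M-module v v∉M
  ...     | inj₂ none = contradiction v~u (none u u∈M)
  ...     | inj₁ all  = twinFree (all x x∈M) (all y y∈M)
              (onlyNeighbour x∈M y∈M x≢y) (onlyNeighbour y∈M x∈M (x≢y ∘ sym))
    where
    ∈⇒≢v : ∀ {x} → x ∈ M → x ≢ v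
    ∈⇒≢v x∈M refl = v∉M x∈M

    onlyNeighbour : ∀ {x y} → x ∈ M → y ∈ M → x ≢ y → ∀ {w} → w ~ x → w ≡ v
    onlyNeighbour {x} {y} x∈M y∈M x≢y {w} w~x with w ≟F v | w ∈? M
    ... | yes w≡v | _       = w≡v
    ... | no  w≢v | yes w∈M = contradiction w~x (subst (λ t → ¬ w ~ t) w≡x (~-irrefl w))
      where
      w≡x : w ≡ x
      -- Otherwise `v`, `x` and `w` would form a triangle.
      w≡x = unique-neighbour acyclic (all x x∈M) (all w w∈M) ((w~x , w≢v , ∈⇒≢v x∈M) ◅ ε)
    ... | no  w≢v | no w∉M with M-module w w∉M
    ...   | inj₂ none = contradiction w~x (none x x∈M)
    -- Now `w` also sees all of `M`, so `v`, `x`, `w`, `y` would form a cycle of length 4.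
    ...   | inj₁ all′ = contradiction
              (unique-neighbour acyclic (all y y∈M) (all x x∈M)
                ((~-sym w~x , ∈⇒≢v x∈M , w≢v) ◅ (all′ y y∈M , w≢v , ∈⇒≢v y∈M) ◅ ε)) x≢y

-- Isomorphisms, induced subtrees and minimality.

module _ {n : ℕ} {Q : Pred (Fin n) 0ℓ} (Q? : Decidable Q) where

  ⟪_⟫ : Subset n
  ⟪_⟫ = tabulate (λ v → does (Q? v))

  ∈⟪⟫⁺ : ∀ {v} → Q v → v ∈ ⟪_⟫
  ∈⟪⟫⁺ {v} q = lookup⇒[]= v _ (trans (lookup∘tabulate _ v) (dec-true (Q? v) q))

  ∈⟪⟫⁻ : ∀ {v} → v ∈ ⟪_⟫ → Q v
  ∈⟪⟫⁻ {v} v∈ with Q? v | trans (sym (lookup∘tabulate (λ v → does (Q? v)) v)) ([]=⇒lookup v∈)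
  ... | yes q | _ = q

mk≅ : ∀ {k m} (H : Graph k) (K : Graph m) (h : Fin k → Fin m) →
      (∀ {u v} → h u ≡ h v → u ≡ v) → (∀ w → ∃ λ u → h u ≡ w) →
      (∀ u v → Graph._~_ H u v → Graph._~_ K (h u) (h v)) →
      (∀ u v → Graph._~_ K (h u) (h v) → Graph._~_ H u v) → H ≅ K
mk≅ H K h injective surjective preserves reflects =
  permutation h (proj₁ ∘ surjective) (proj₂ ∘ surjective)
    (λ u → injective (proj₂ (surjective (h u)))) ,
  λ u v → T-ext (preserves u v) (reflects u v)
  where
  T-ext : ∀ {a b} → (T a → T b) → (T b → T a) → a ≡ b
  T-ext {false} {false} _ _ = refl
  T-ext {false} {true}  _ g = ⊥-elim (g _)
  T-ext {true}  {false} f _ = ⊥-elim (f _)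
  T-ext {true}  {true}  _ _ = refl

-- The preimage of a module under an isomorphism is a module.
indecomposable-≅ : ∀ {k m} {H : Graph k} {K : Graph m} → H ≅ K →
                   Indecomposable H → Indecomposable K
indecomposable-≅ {H = H} {K} (π , adj≡) indec M M-module x∈M y∈M z∉M =
  trans (sym (inverseʳ π)) (trans (cong (π ⟨$⟩ʳ_)
    (indec M′ M′-module (pull x∈M) (pull y∈M) (z∉M ∘ subst (_∈ M) (inverseʳ π) ∘ ∈⟪⟫⁻ Q?)))
    (inverseʳ π))
  where
  Q? : Decidable (λ u → π ⟨$⟩ʳ u ∈ M)
  Q? u = π ⟨$⟩ʳ u ∈? M
  M′ : Subset _
  M′ = ⟪ Q? ⟫
  pull : ∀ {x} → x ∈ M → π ⟨$⟩ˡ x ∈ M′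
  pull x∈M = ∈⟪⟫⁺ Q? (subst (_∈ M) (sym (inverseʳ π)) x∈M)
  M′-module : IsModule H M′
  M′-module v v∉M′ with M-module (π ⟨$⟩ʳ v) (v∉M′ ∘ ∈⟪⟫⁺ Q?)
  ... | inj₁ all  = inj₁ λ x x∈ → subst T (sym (adj≡ v x)) (all _ (∈⟪⟫⁻ Q? x∈))
  ... | inj₂ none = inj₂ λ x x∈ v~x → none _ (∈⟪⟫⁻ Q? x∈) (subst T (adj≡ v x) v~x)

module _ {P : ℕ → ℕ} (P≤ : Decreasing P) where

  treeGraph-connected : ∀ n → IsConnected (treeGraph P P≤ n)
  treeGraph-connected (suc n) u v =
    toRoot (toℕ u) u refl ◅◅ reverse (λ {x} {y} → ~-sym {x} {y}) (toRoot (toℕ v) v refl)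
    where
    open Graph (treeGraph P P≤ (suc n))
    toRoot : ∀ i (u : Fin (suc n)) → toℕ u ≡ i → Star _~_ u zero
    toRoot = <-rec _ λ where
      i rec zero    eq   → ε
      _ rec (suc u) refl →
        let P<n = ≤-trans (s≤s (P≤ (toℕ u))) (<⇒≤ (toℕ<n (suc u)))
            p   = fromℕ< P<n
            toℕp = toℕ-fromℕ< P<n
        in adjacentˡ {P} {suc (toℕ u)} {toℕ p}
             (subst (Child P (suc (toℕ u))) (sym toℕp) (child⁺ {P} (toℕ u)))
           ◅ rec (s≤s (≤-trans (≤-reflexive toℕp) (P≤ (toℕ u)))) p refl

  private
    -- These are the predecessor and the successor on the cycle; the first and the last position
    -- wrap around.
    cycle-neighbours : ∀ {k} (i : Fin (3 + k)) (_~_ : Rel (Fin (3 + k)) 0ℓ) → Symmetric _~_ →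
      (∀ i → inject₁ i ~ suc i) → fromℕ (2 + k) ~ zero →
      ∃₂ λ p q → p ≢ q × i ~ p × i ~ q
    cycle-neighbours {k} zero _~_ sym~ step close =
      fromℕ (2 + k) , suc zero , (λ ()) , sym~ close , step zero
    cycle-neighbours {k} (suc i) _~_ sym~ step close with view i
    ... | ‵fromℕ = inject₁ i , zero , (λ ()) , sym~ (step i) , close
    ... | ‵inject₁ j = inject₁ i , suc (suc j) , distinct , sym~ (step i) , step (suc j)
      where
      distinct : inject₁ (inject₁ j) ≢ suc (suc j)
      distinct eq = <⇒≢ (m<n⇒m<1+n ≤-refl) (trans (sym (trans (toℕ-inject₁ (inject₁ j)) (toℕ-inject₁ j))) (cong toℕ eq))

  -- On a cycle every vertex has a larger neighbour, since it has two
  -- neighbours but only one parent.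
  treeGraph-acyclic : ∀ n → ¬ HasCycle (treeGraph P P≤ n)
  treeGraph-acyclic n (k , c , c-injective , c-edge , c-closed) = ascend zero (>-wellFounded (c zero))
    where
    open Graph (treeGraph P P≤ n)
    larger : ∀ i → ∃ λ j → toℕ (c i) < toℕ (c j)
    larger i with cycle-neighbours i (λ i j → c i ~ c j) (λ {x} {y} → ~-sym {c x} {c y}) c-edge c-closed
    ... | p , q , p≢q , i~p , i~q
      with adjacent⁻ {P} {toℕ (c i)} {toℕ (c p)} i~p | adjacent⁻ {P} {toℕ (c i)} {toℕ (c q)} i~q
    ... | inj₂ up | _       = p , child-< P≤ {toℕ (c p)} up
    ... | _       | inj₂ up = q , child-< P≤ {toℕ (c q)} up
    ... | inj₁ p↓ | inj₁ q↓ = contradiction (c-injective (toℕ-injective (oneParent (toℕ (c i)) p↓ q↓))) p≢q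
      where
      oneParent : ∀ i {x y} → Child P i x → Child P i y → x ≡ y
      oneParent (suc w) x↓ y↓ = trans (sym (child⁻ {P} {w} x↓)) (child⁻ {P} {w} y↓)
    -- Passing to larger neighbours cannot go on forever in a finite set.
    ascend : ∀ i → Acc Fin._>_ (c i) → ⊥
    ascend i (acc rec) with larger i
    ... | j , i<j = ascend j (rec i<j)

  treeGraph-isTree : ∀ n → IsTree (treeGraph P P≤ (suc n))
  treeGraph-isTree n = s≤s z≤n , treeGraph-connected (suc n) , treeGraph-acyclic (suc n)

  module _ {n : ℕ} (G : Graph n) (acyclic : ¬ HasCycle G) {k : ℕ} {f : ℕ → Fin n}
           (e : Embeds (Graph._~_ G) P k f) where
    open Graph G

    -- `enum` lists `S` in the order of the ambient vertices, not of the labels; `h` sends a label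
    -- to the position of its vertex in that list.
    inducedTree : ∀ S → (∀ {j} → j < k → f j ∈ S) → (∀ {v} → v ∈ S → Image k f v) →
                  treeGraph P P≤ k ≅ G [[ S ]]
    inducedTree S f∈S covers = mk≅ (treeGraph P P≤ k) (G [[ S ]]) h
      (λ {u} {v} eq → toℕ-injective (e .injective (toℕ<n u) (toℕ<n v)
        (trans (sym (enum-h u)) (trans (cong (enum S) eq) (enum-h v)))))
      surjective
      (λ u v a → subst₂ _~_ (sym (enum-h u)) (sym (enum-h v))
        (embeds-preserves G e (toℕ<n u) (toℕ<n v) a))
      (λ u v a → embeds-reflects G P≤ acyclic e (toℕ<n u) (toℕ<n v)
        (subst₂ _~_ (enum-h u) (enum-h v) a))
      where
      h : Fin k → Fin ∣ S ∣
      h i = proj₁ (enum-surjective S (f∈S (toℕ<n i)))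
      enum-h : ∀ i → enum S (h i) ≡ f (toℕ i)
      enum-h i = proj₂ (enum-surjective S (f∈S (toℕ<n i)))
      surjective : ∀ w → ∃ λ u → h u ≡ w
      surjective w with covers (enum-∈ S w)
      ... | j , j<k , eq = fromℕ< j<k ,
        enum-injective S (trans (enum-h (fromℕ< j<k)) (trans (cong f (toℕ-fromℕ< j<k)) eq))

    spanningTree : (∀ v → Image k f v) → treeGraph P P≤ k ≅ G
    spanningTree covers = mk≅ (treeGraph P P≤ k) G (f ∘ toℕ)
      (λ {u} {v} eq → toℕ-injective (e .injective (toℕ<n u) (toℕ<n v) eq))
      (λ w → let j , j<k , eq = covers w in fromℕ< j<k , trans (cong f (toℕ-fromℕ< j<k)) eq)
      (λ u v → embeds-preserves G e (toℕ<n u) (toℕ<n v))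
      (λ u v → embeds-reflects G P≤ acyclic e (toℕ<n u) (toℕ<n v))

    -- If the embedding missed a vertex, its image would be a proper vertex subset containing `X`
    -- that induces a prime tree, against minimality.
    minimal⇒≅ : 4 ≤ k → Indecomposable (treeGraph P P≤ k) → ∀ {X} → IsMinimalFor G X →
                (∀ {x} → x ∈ X → Image k f x) → treeGraph P P≤ k ≅ G
    minimal⇒≅ 4≤k indec {X} (_ , minimal) covers = spanningTree λ v →
      decidable-stable (image? _≟F_ k f v) λ v∉ →
        minimal S (∈⟪⟫⁺ Q? ∘ covers) (⊆⊤ , v , ∈⊤ , v∉ ∘ ∈⟪⟫⁻ Q?) S-prime
      where
      Q? : Decidable (Image k f)
      Q? = image? _≟F_ k f
      S : Subset n
      S = ⟪ Q? ⟫
      iso : treeGraph P P≤ k ≅ G [[ S ]]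
      iso = inducedTree S (λ j<k → ∈⟪⟫⁺ Q? (_ , j<k , refl)) (∈⟪⟫⁻ Q?)
      S-prime : IsPrime (G [[ S ]])
      S-prime = ≤-trans 4≤k (≤-reflexive (↔⇒≡ (proj₁ iso))) ,
        indecomposable⇒trivial (G [[ S ]])
          (indecomposable-≅ {H = treeGraph P P≤ k} {G [[ S ]]} iso indec)

-- Both sides of a disconnection are modules. By the pigeonhole principle one of them has two
-- elements, and it misses a vertex of the other side.
prime⇒noCut : ∀ {n} (G : Graph n) → IsPrime G → {Q : Pred (Fin n) 0ℓ} (Q? : Decidable Q) →
              (∀ {u w} → Q u → ¬ Q w → ¬ Graph._~_ G u w) →
              ∀ {x z} → Q x → ¬ Q z → ⊥
prime⇒noCut {n} G prime {Q} Q? cut {x} {z} Qx ¬Qz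
  with pigeonhole (≤-trans (s≤s (s≤s (s≤s z≤n))) (proj₁ prime)) side
  where
  side : Fin n → Fin 2
  side v with Q? v
  ... | yes _ = zero
  ... | no  _ = suc zero
... | i , j , i<j , same with Q? i | Q? j
...   | yes Qi | yes Qj = contradiction (cong toℕ (prime⇒indecomposable G prime ⟪ Q? ⟫
          (λ v v∉ → inj₂ λ u u∈ v~u → cut (∈⟪⟫⁻ Q? u∈) (v∉ ∘ ∈⟪⟫⁺ Q?) (Graph.~-sym G v~u))
          (∈⟪⟫⁺ Q? Qi) (∈⟪⟫⁺ Q? Qj) (¬Qz ∘ ∈⟪⟫⁻ Q?))) (<⇒≢ i<j)
...   | no ¬Qi | no ¬Qj = contradiction (cong toℕ (prime⇒indecomposable G prime ⟪ ¬? ∘ Q? ⟫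
          (λ v v∉ → inj₂ λ u u∈ v~u → cut (decidable-stable (Q? v) (v∉ ∘ ∈⟪⟫⁺ (¬? ∘ Q?))) (∈⟪⟫⁻ (¬? ∘ Q?) u∈) v~u)
          (∈⟪⟫⁺ (¬? ∘ Q?) ¬Qi) (∈⟪⟫⁺ (¬? ∘ Q?) ¬Qj) (λ z∈ → ∈⟪⟫⁻ (¬? ∘ Q?) z∈ Qx))) (<⇒≢ i<j)
...   | yes _ | no _ with () ← same
...   | no _ | yes _ with () ← same

cutInduced⇒¬prime : ∀ {n} (G : Graph n) S {Q : Pred (Fin n) 0ℓ} → Decidable Q →
  (∀ {u w} → u ∈ S → w ∈ S → Q u → ¬ Q w → ¬ Graph._~_ G u w) →
  ∀ {x z} → x ∈ S → z ∈ S → Q x → ¬ Q z → ¬ IsPrime (G [[ S ]])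
cutInduced⇒¬prime G S {Q} Q? cut x∈S z∈S Qx ¬Qz prime
  with enum-surjective S x∈S | enum-surjective S z∈S
... | i , refl | j , refl =
  prime⇒noCut (G [[ S ]]) prime (Q? ∘ enum S) (cut (enum-∈ S _) (enum-∈ S _)) Qx ¬Qz

-- Paths and spiders are 3-minimal

module _ {P : ℕ → ℕ} (P≤ : Decreasing P) (s : ℕ) where

  -- Stated for labels in ℕ rather than `Fin`, so that finding the leaves becomes arithmetic on
  -- parents.
  Leaf : ℕ → ℕ → Set
  Leaf x v = ∀ j → j ≤ s → Adjacent P j x → j ≡ v

  noTwinLeaves : (∀ {x y v} → x ≤ s → y ≤ s → Leaf x v → Leaf y v → x ≡ y) →
                 NoTwinLeaves (treeGraph P P≤ (suc s))
  noTwinLeaves twinFree {v} {x} {y} _ _ x-leaf y-leaf = toℕ-injective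
    (twinFree (≤-pred (toℕ<n x)) (≤-pred (toℕ<n y)) (leaf x x-leaf) (leaf y y-leaf))
    where
    leaf : ∀ x → (∀ {w} → Graph._~_ (treeGraph P P≤ (suc s)) w x → w ≡ v) → Leaf (toℕ x) (toℕ v)
    leaf x only j j≤s a = trans (sym toℕw) (cong toℕ (only {fromℕ< (s≤s j≤s)}
      (subst (λ i → Adjacent P i (toℕ x)) (sym toℕw) a)))
      where
      toℕw : toℕ (fromℕ< (s≤s j≤s)) ≡ j
      toℕw = toℕ-fromℕ< (s≤s j≤s)

  leaf-parent : ∀ {w v} → w < s → Leaf (suc w) v → P w ≡ v
  leaf-parent {w} w<s leaf = leaf _ (≤-trans (P≤ w) (<⇒≤ w<s)) (adjacentʳ {P} {P w} {suc w} (child⁺ {P} w))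

  leaf-child : ∀ {x v} → x < s → P x ≡ x → Leaf x v → suc x ≡ v
  leaf-child {x} x<s eq leaf = leaf _ x<s (adjacentˡ {P} {suc x} {x} (subst (Child P (suc x)) eq (child⁺ {P} x)))

  -- The parent lies below the label and a child above it, so there are two distinct neighbours.
  leaf-inner : ∀ {w v} → suc w < s → P (suc w) ≡ suc w → ¬ Leaf (suc w) v
  leaf-inner {w} w<s eq leaf = <⇒≢ (s≤s (≤-trans (P≤ w) (n≤1+n w)))
    (trans (leaf-parent (<⇒≤ w<s) leaf) (sym (leaf-child w<s eq leaf)))

id-decreasing : Decreasing id
id-decreasing _ = ≤-refl

-- The leaves 0 and `s` hang on 1 and on s - 1, which would coincide only for s = 2.
path-indecomposable : ∀ {s} → 3 ≤ s → Indecomposable (treeGraph id id-decreasing (suc s))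
path-indecomposable {s} 3≤s = noTwinLeaves⇒indecomposable (treeGraph id id-decreasing (suc s)) (treeGraph-connected id-decreasing (suc s))
  (treeGraph-acyclic id-decreasing (suc s)) (noTwinLeaves id-decreasing s twinFree)
  where
  classify : ∀ {x v} → x ≤ s → Leaf id-decreasing s x v → (x ≡ 0 × v ≡ 1) ⊎ (x ≡ s × suc v ≡ s)
  classify {zero}  _   leaf = inj₁ (refl , sym (leaf-child id-decreasing s (≤-trans (s≤s z≤n) 3≤s) refl leaf))
  classify {suc w} x≤s leaf with m≤n⇒m<n∨m≡n x≤s
  ... | inj₁ x<s  = contradiction leaf (leaf-inner id-decreasing s x<s refl)
  ... | inj₂ refl = inj₂ (refl , cong suc (sym (leaf-parent id-decreasing s ≤-refl leaf)))
  twinFree : ∀ {x y v} → x ≤ s → y ≤ s → Leaf id-decreasing s x v → Leaf id-decreasing s y v → x ≡ y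
  twinFree x≤s y≤s x-leaf y-leaf with classify x≤s x-leaf | classify y≤s y-leaf
  ... | inj₁ (refl , _)    | inj₁ (refl , _)    = refl
  ... | inj₂ (refl , _)    | inj₂ (refl , _)    = refl
  ... | inj₁ (refl , refl) | inj₂ (refl , refl) = contradiction 3≤s λ { (s≤s (s≤s ())) }
  ... | inj₂ (refl , refl) | inj₁ (refl , refl) = contradiction 3≤s λ { (s≤s (s≤s ())) }

module _ {a m s : ℕ} (a≤m : a ≤ m) (3≤m : 3 ≤ m) (m+2≤s : suc (suc m) ≤ s) where

  private
    P≤ : Decreasing (spider a m)
    P≤ = spider-decreasing a≤m

  -- Only 0, `m` and `s` can be leaves, with neighbours 1, m - 1 and s - 1. The bound on `m`
  -- separates the first two. By the bound on `s` the third leg has at least two vertices, so its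
  -- end hangs on s - 1, beyond `m`, and not on the centre.
  spider-indecomposable : Indecomposable (treeGraph (spider a m) P≤ (suc s))
  spider-indecomposable = noTwinLeaves⇒indecomposable (treeGraph (spider a m) P≤ (suc s)) (treeGraph-connected P≤ (suc s))
    (treeGraph-acyclic P≤ (suc s)) (noTwinLeaves P≤ s twinFree)
    where
    classify : ∀ {x v} → x ≤ s → Leaf P≤ s x v →
               (x ≡ 0 × v ≡ 1) ⊎ (x ≡ m × suc v ≡ m) ⊎ (x ≡ s × suc v ≡ s)
    classify {zero} _ leaf = inj₁ (refl , sym (leaf-child P≤ s (≤-trans (s≤s z≤n) m+2≤s)
      (spider-≢ a (<⇒≢ (≤-trans (s≤s z≤n) 3≤m))) leaf))
    classify {suc w} {v} x≤s leaf with suc w ≟ m | m≤n⇒m<n∨m≡n x≤s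
    ... | yes refl | _         = inj₂ (inj₁ (refl , cong suc
      (trans (sym (leaf-parent P≤ s x≤s leaf)) (spider-≢ a (<⇒≢ ≤-refl)))))
    ... | no  w≢m  | inj₁ x<s  = contradiction leaf (leaf-inner P≤ s x<s (spider-≢ a w≢m))
    ... | no  w≢m  | inj₂ refl = inj₂ (inj₂ (refl , cong suc
      (trans (sym (leaf-parent P≤ s ≤-refl leaf)) (spider-≢ a (>⇒≢ (≤-pred m+2≤s))))))
    twinFree : ∀ {x y v} → x ≤ s → y ≤ s → Leaf P≤ s x v → Leaf P≤ s y v → x ≡ y
    twinFree x≤s y≤s x-leaf y-leaf with classify x≤s x-leaf | classify y≤s y-leaf
    ... | inj₁ (refl , _)           | inj₁ (refl , _)           = refl
    ... | inj₂ (inj₁ (refl , _))    | inj₂ (inj₁ (refl , _))    = refl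
    ... | inj₂ (inj₂ (refl , _))    | inj₂ (inj₂ (refl , _))    = refl
    ... | inj₁ (_ , refl)           | inj₂ (inj₁ (_ , refl))    = contradiction 3≤m λ { (s≤s (s≤s ())) }
    ... | inj₂ (inj₁ (_ , refl))    | inj₁ (_ , refl)           = contradiction 3≤m λ { (s≤s (s≤s ())) }
    ... | inj₁ (_ , refl)           | inj₂ (inj₂ (_ , refl))    = contradiction (≤-trans 3≤m (≤-pred (<⇒≤ m+2≤s))) λ { (s≤s ()) }
    ... | inj₂ (inj₂ (_ , refl))    | inj₁ (_ , refl)           = contradiction (≤-trans 3≤m (≤-pred (<⇒≤ m+2≤s))) λ { (s≤s ()) }
    -- Both labels are the successor of the common neighbour, hence equal.
    ... | inj₂ (inj₁ (refl , refl)) | inj₂ (inj₂ (refl , refl)) = refl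
    ... | inj₂ (inj₂ (refl , refl)) | inj₂ (inj₁ (refl , refl)) = refl

∣⁅x⁆∪p∣ : ∀ {n} (x : Fin n) p → x ∉ p → ∣ ⁅ x ⁆ ∪ p ∣ ≡ suc ∣ p ∣
∣⁅x⁆∪p∣ zero    (inside  ∷ p) x∉p = contradiction here x∉p
∣⁅x⁆∪p∣ zero    (outside ∷ p) x∉p = cong (suc ∘ ∣_∣) (∪-identityˡ p)
∣⁅x⁆∪p∣ (suc x) (inside  ∷ p) x∉p = cong suc (∣⁅x⁆∪p∣ x p (x∉p ∘ there))
∣⁅x⁆∪p∣ (suc x) (outside ∷ p) x∉p = ∣⁅x⁆∪p∣ x p (x∉p ∘ there)

triple : ∀ {n} → Fin n → Fin n → Fin n → Subset n
triple x y z = ⁅ x ⁆ ∪ (⁅ y ⁆ ∪ ⁅ z ⁆)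

∣triple∣ : ∀ {n} {x y z : Fin n} → x ≢ y → x ≢ z → y ≢ z → ∣ triple x y z ∣ ≡ 3
∣triple∣ {x = x} {y} {z} x≢y x≢z y≢z = trans
  (∣⁅x⁆∪p∣ x _ λ x∈ → [ x≢y ∘ x∈⁅y⁆⇒x≡y y , x≢z ∘ x∈⁅y⁆⇒x≡y z ]′ (x∈p∪q⁻ ⁅ y ⁆ ⁅ z ⁆ x∈))
  (cong suc (trans (∣⁅x⁆∪p∣ y ⁅ z ⁆ (y≢z ∘ x∈⁅y⁆⇒x≡y z)) (cong suc (∣⁅x⁆∣≡1 z))))

module _ {n} {x y z : Fin n} where
  ∈triple₁ : x ∈ triple x y z
  ∈triple₁ = x∈p∪q⁺ (inj₁ (x∈⁅x⁆ x))
  ∈triple₂ : y ∈ triple x y z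
  ∈triple₂ = x∈p∪q⁺ {p = ⁅ x ⁆} (inj₂ (x∈p∪q⁺ (inj₁ (x∈⁅x⁆ y))))
  ∈triple₃ : z ∈ triple x y z
  ∈triple₃ = x∈p∪q⁺ {p = ⁅ x ⁆} (inj₂ (x∈p∪q⁺ {p = ⁅ y ⁆} (inj₂ (x∈⁅x⁆ z))))

indecomposable⇒prime : ∀ {n} (G : Graph n) → 4 ≤ n → Indecomposable G → IsPrime G
indecomposable⇒prime G 4≤n indec = 4≤n , indecomposable⇒trivial G indec

module _ {P : ℕ → ℕ} (P≤ : Decreasing P) {s : ℕ} where

  private
    G : Graph (suc s)
    G = treeGraph P P≤ (suc s)

  label : ∀ {j} → j ≤ s → Fin (suc s)
  label j≤s = fromℕ< (s≤s j≤s)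

  toℕ-label : ∀ {j} (j≤s : j ≤ s) → toℕ (label j≤s) ≡ j
  toℕ-label j≤s = toℕ-fromℕ< (s≤s j≤s)

  -- `Q` singles out the labels on one side of the missing vertex `v`; it suffices to check it along
  -- the edges from a child to its parent that avoid `v`.
  cut⇒¬prime : ∀ S (Q : ℕ → Set) → (∀ i → Dec (Q i)) → ∀ {v} → v ∉ S →
    (∀ {i j} → Child P i j → i ≢ toℕ v → j ≢ toℕ v → (Q i → Q j) × (Q j → i ≤ s → Q i)) →
    ∀ {x z} → x ∈ S → z ∈ S → Q (toℕ x) → ¬ Q (toℕ z) → ¬ IsPrime (G [[ S ]])
  cut⇒¬prime S Q Q? {v} v∉S closed = cutInduced⇒¬prime G S (Q? ∘ toℕ) cut
    where
    ≢v : ∀ {u} → u ∈ S → toℕ u ≢ toℕ v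
    ≢v u∈S eq = v∉S (subst (_∈ S) (toℕ-injective eq) u∈S)
    cut : ∀ {u w} → u ∈ S → w ∈ S → Q (toℕ u) → ¬ Q (toℕ w) → ¬ Graph._~_ G u w
    cut {u} {w} u∈S w∈S Qu ¬Qw u~w with adjacent⁻ {P} {toℕ u} {toℕ w} u~w
    ... | inj₁ c = ¬Qw (proj₁ (closed {toℕ u} c (≢v u∈S) (≢v w∈S)) Qu)
    ... | inj₂ c = ¬Qw (proj₂ (closed {toℕ w} c (≢v w∈S) (≢v u∈S)) Qu (≤-pred (toℕ<n w)))

  module _ {j} (0<j : 0 < j) (j<s : j < s) where

    ends : Subset (suc s)
    ends = triple zero (label (<⇒≤ j<s)) (label ≤-refl)

    isMinimal₃ : 4 ≤ suc s → Indecomposable G →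
      (∀ S → zero ∈ S → label (<⇒≤ j<s) ∈ S → label ≤-refl ∈ S → ∀ v → v ∉ S → ¬ IsPrime (G [[ S ]])) →
      IsMinimal 3 G
    isMinimal₃ 4≤ indec minimal = ends ,
      ∣triple∣ (λ eq → <⇒≢ 0<j (trans (cong toℕ eq) (toℕ-label (<⇒≤ j<s))))
        (λ eq → <⇒≢ (<-trans 0<j j<s) (trans (cong toℕ eq) (toℕ-label ≤-refl)))
        (λ eq → <⇒≢ j<s (trans (sym (toℕ-label (<⇒≤ j<s))) (trans (cong toℕ eq) (toℕ-label ≤-refl)))) ,
      indecomposable⇒prime G 4≤ indec ,
      λ { S X⊆S (_ , v , _ , v∉S) → minimal S (X⊆S ∈triple₁)
            (X⊆S (∈triple₂ {x = zero})) (X⊆S (∈triple₃ {x = zero} {label (<⇒≤ j<s)})) v v∉S }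

-- Removing `v` separates the labels below it from those above, hence 0 from `s`. The label 1 only
-- completes the two leaves to a set of three vertices.
path-minimal : ∀ {s} → 3 ≤ s → IsMinimal 3 (treeGraph id id-decreasing (suc s))
path-minimal {s} 3≤s = isMinimal₃ id-decreasing {j = 1} (s≤s z≤n) (<⇒≤ 3≤s) (s≤s 3≤s) (path-indecomposable 3≤s)
  λ S 0∈S _ s∈S v v∉S → cut⇒¬prime id-decreasing S (_< toℕ v) (_<? toℕ v) v∉S
    closed 0∈S s∈S
    (n≢0⇒n>0 λ eq → v∉S (subst (_∈ S) (sym (toℕ-injective eq)) 0∈S))
    (≤⇒≯ (≤-trans (≤-pred (toℕ<n v)) (≤-reflexive (sym (toℕ-label {id} id-decreasing ≤-refl)))))
  where
  closed : ∀ {v i j} → Child id i j → i ≢ v → j ≢ v → (i < v → j < v) × (j < v → i ≤ s → i < v)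
  closed {v} {suc w} {j} c i≢v j≢v with child⁻ {id} {w} {j} c
  ... | refl = (λ i<v → <⇒≤ i<v) , λ j<v _ → ≤∧≢⇒< j<v i≢v

-- The chosen vertices are 0, `m` and `s`. A missing `v` up to the centre cuts off the labels below
-- `v`, with 0 among them; one on the second leg cuts off the rest of that leg, with `m`; one on the
-- third leg cuts off the labels above `v`, with `s`.
spider-minimal : ∀ {a m s} (a≤m : a ≤ m) → 3 ≤ m → suc (suc m) ≤ s →
                 IsMinimal 3 (treeGraph (spider a m) (spider-decreasing a≤m) (suc s))
spider-minimal {a} {m} {s} a≤m 3≤m m+2≤s =
  isMinimal₃ P≤ {j = m} (≤-trans (s≤s z≤n) 3≤m) m<s (s≤s (≤-trans 3≤m (<⇒≤ m<s)))
    (spider-indecomposable a≤m 3≤m m+2≤s) minimal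
  where
  P≤ : Decreasing (spider a m)
  P≤ = spider-decreasing a≤m
  m<s : m < s
  m<s = <⇒≤ m+2≤s

  minimal : ∀ S → zero ∈ S → label P≤ (<⇒≤ m<s) ∈ S → label P≤ ≤-refl ∈ S → ∀ v → v ∉ S →
            ¬ IsPrime (treeGraph (spider a m) P≤ (suc s) [[ S ]])
  minimal S 0∈S m∈S s∈S v v∉S with toℕ v ≤? a | toℕ v ≤? m
  ... | yes v≤a | _ = cut⇒¬prime P≤ S (_< toℕ v) (_<? toℕ v) v∉S closed 0∈S s∈S
    (n≢0⇒n>0 λ eq → v∉S (subst (_∈ S) (sym (toℕ-injective eq)) 0∈S))
    (≤⇒≯ (≤-trans (≤-pred (toℕ<n v)) (≤-reflexive (sym (toℕ-label P≤ ≤-refl)))))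
    where
    closed : ∀ {i j} → Child (spider a m) i j → i ≢ toℕ v → j ≢ toℕ v →
             (i < toℕ v → j < toℕ v) × (j < toℕ v → i ≤ s → i < toℕ v)
    closed {suc w} {j} c i≢v j≢v with w ≟ m | child⁻ {spider a m} {w} {j} c
    ... | yes refl | refl = (λ i<v → contradiction (≤-trans i<v (≤-trans v≤a a≤m)) (<⇒≱ (m<n⇒m<1+n ≤-refl))) ,
      λ j<v → contradiction (≤-trans v≤a (≤-reflexive (sym (spider-≡ a m)))) (<⇒≱ j<v)
    ... | no w≢m | refl rewrite spider-≢ a w≢m = (λ i<v → <⇒≤ i<v) , λ j<v _ → ≤∧≢⇒< j<v i≢v
  ... | no v≰a | yes v≤m = cut⇒¬prime P≤ S (λ i → toℕ v < i × i ≤ m)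
    (λ i → toℕ v <? i ×-dec i ≤? m) v∉S closed m∈S 0∈S
    (≤∧≢⇒< (≤-trans v≤m (≤-reflexive (sym (toℕ-label P≤ (<⇒≤ m<s)))))
      (λ eq → v∉S (subst (_∈ S) (sym (toℕ-injective eq)) m∈S)) , ≤-reflexive (toℕ-label P≤ (<⇒≤ m<s)))
    λ ()
    where
    closed : ∀ {i j} → Child (spider a m) i j → i ≢ toℕ v → j ≢ toℕ v →
             (toℕ v < i × i ≤ m → toℕ v < j × j ≤ m) × (toℕ v < j × j ≤ m → i ≤ s → toℕ v < i × i ≤ m)
    closed {suc w} {j} c i≢v j≢v with w ≟ m | child⁻ {spider a m} {w} {j} c
    ... | yes refl | refl = (λ (_ , m<m) → contradiction m<m (<⇒≱ ≤-refl)) ,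
      λ (v<j , _) → contradiction (≤-trans v<j (≤-reflexive (spider-≡ a m))) λ v<a → v≰a (<⇒≤ v<a)
    ... | no w≢m | refl rewrite spider-≢ a w≢m =
      (λ (v<i , i≤m) → ≤∧≢⇒< (≤-pred v<i) (j≢v ∘ sym) , <⇒≤ i≤m) ,
      λ (v<j , j≤m) _ → m<n⇒m<1+n v<j , ≤∧≢⇒< j≤m w≢m
  ... | no v≰a | no v≰m = cut⇒¬prime P≤ S (toℕ v <_) (toℕ v <?_) v∉S closed s∈S 0∈S
    (≤∧≢⇒< (≤-trans (≤-pred (toℕ<n v)) (≤-reflexive (sym (toℕ-label P≤ ≤-refl))))
      (λ eq → v∉S (subst (_∈ S) (sym (toℕ-injective eq)) s∈S)))
    λ ()
    where
    closed : ∀ {i j} → Child (spider a m) i j → i ≢ toℕ v → j ≢ toℕ v →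
             (toℕ v < i → toℕ v < j) × (toℕ v < j → i ≤ s → toℕ v < i)
    closed {suc w} {j} c i≢v j≢v with w ≟ m | child⁻ {spider a m} {w} {j} c
    ... | yes refl | refl = (λ v<i → contradiction (≤-pred v<i) v≰m) ,
      λ v<j _ → <-trans v<j (s≤s (P≤ m))
    ... | no w≢m | refl rewrite spider-≢ a w≢m =
      (λ v<i → ≤∧≢⇒< (≤-pred v<i) (j≢v ∘ sym)) , λ v<j _ → m<n⇒m<1+n v<j

-- Leg lengths as isomorphism invariants

module _ {n : ℕ} (G : Graph n) where
  open Graph G

  -- Degree at least three, given by witnesses that an isomorphism can carry over.
  Branching : Fin n → Set
  Branching x = ∃ λ u → ∃₂ λ v w → u ≢ v × u ≢ w × v ≢ w × x ~ u × x ~ v × x ~ w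

  -- Non-backtracking walks of length ℓ from v to a leaf, arriving at v from u.
  data Ray : Fin n → Fin n → ℕ → Set where
    stop : ∀ {u v} → (∀ {w} → v ~ w → w ≡ u) → Ray u v 0
    step : ∀ {u v w ℓ} → v ~ w → w ≢ u → Ray v w ℓ → Ray u v (suc ℓ)

  Leg : ℕ → Set
  Leg ℓ = ∃₂ λ z v → Branching z × z ~ v × ∃ λ k → ℓ ≡ suc k × Ray z v k

module _ {n k : ℕ} {G : Graph n} {H : Graph k} (iso : G ≅ H) where

  private
    module G = Graph G
    module H = Graph H
    π : Fin n → Fin k
    π u = proj₁ iso ⟨$⟩ʳ u

    π-injective : ∀ {u v} → π u ≡ π v → u ≡ v
    π-injective eq = trans (sym (inverseˡ (proj₁ iso)))
      (trans (cong (proj₁ iso ⟨$⟩ˡ_) eq) (inverseˡ (proj₁ iso)))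

    preserves : ∀ {u v} → u G.~ v → π u H.~ π v
    preserves {u} {v} = subst T (proj₂ iso u v)

  branching-≅ : ∀ {x} → Branching G x → Branching H (π x)
  branching-≅ (u , v , w , u≢v , u≢w , v≢w , x~u , x~v , x~w) =
    π u , π v , π w , u≢v ∘ π-injective , u≢w ∘ π-injective , v≢w ∘ π-injective ,
    preserves x~u , preserves x~v , preserves x~w

  ray-≅ : ∀ {u v ℓ} → Ray G u v ℓ → Ray H (π u) (π v) ℓ
  ray-≅ {u} {v} (stop only) = stop λ {w} v~w → trans (sym (inverseʳ (proj₁ iso)))
    (cong π (only (subst T (sym (proj₂ iso v _)) (subst (π v H.~_) (sym (inverseʳ (proj₁ iso))) v~w))))
  ray-≅ (step v~w w≢u ray) = step (preserves v~w) (w≢u ∘ π-injective) (ray-≅ ray)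

  leg-≅ : ∀ {ℓ} → Leg G ℓ → Leg H ℓ
  leg-≅ (z , v , z-branching , z~v , k , eq , ray) =
    π z , π v , branching-≅ z-branching , preserves z~v , k , eq , ray-≅ ray

module _ {P : ℕ → ℕ} (P≤ : Decreasing P) (s : ℕ) where

  private
    G : Graph (suc s)
    G = treeGraph P P≤ (suc s)

  child-unique : ∀ {i x y} → Child P i x → Child P i y → x ≡ y
  child-unique {suc w} i↓x i↓y = trans (sym (child⁻ {P} {w} i↓x)) (child⁻ {P} {w} i↓y)

  private
    isSuc : ∀ {x} → (∀ w → P w ≡ x → w ≡ x) → ∀ i → Child P i x → i ≡ suc x
    isSuc only (suc w) c = cong suc (only w (child⁻ {P} {w} c))

  -- The hypothesis leaves `suc (toℕ x)` as the only possible child. Of three neighbours, two would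
  -- both be the parent or both be this child.
  notBranching : ∀ {x} → (∀ w → P w ≡ toℕ x → w ≡ toℕ x) → ¬ Branching G x
  notBranching {x} only (u , v , w , u≢v , u≢w , v≢w , x~u , x~v , x~w)
    with adjacent⁻ {P} {toℕ x} {toℕ u} x~u | adjacent⁻ {P} {toℕ x} {toℕ v} x~v | adjacent⁻ {P} {toℕ x} {toℕ w} x~w
  ... | inj₁ p | inj₁ q | _      = u≢v (toℕ-injective (child-unique {toℕ x} p q))
  ... | inj₁ p | _      | inj₁ r = u≢w (toℕ-injective (child-unique {toℕ x} p r))
  ... | _      | inj₁ q | inj₁ r = v≢w (toℕ-injective (child-unique {toℕ x} q r))
  ... | inj₂ p | inj₂ q | _      = u≢v (toℕ-injective (trans (isSuc only (toℕ u) p) (sym (isSuc only (toℕ v) q))))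
  ... | inj₂ p | _      | inj₂ r = u≢w (toℕ-injective (trans (isSuc only (toℕ u) p) (sym (isSuc only (toℕ w) r))))
  ... | _      | inj₂ q | inj₂ r = v≢w (toℕ-injective (trans (isSuc only (toℕ v) q) (sym (isSuc only (toℕ w) r))))

  adjacent-labels : ∀ {i j} (i≤s : i ≤ s) (j≤s : j ≤ s) → Adjacent P i j →
                    Graph._~_ G (label P≤ i≤s) (label P≤ j≤s)
  adjacent-labels i≤s j≤s = subst₂ (Adjacent P) (sym (toℕ-label P≤ i≤s)) (sym (toℕ-label P≤ j≤s))

module _ {a m s : ℕ} (0<a : 0 < a) (a<m : a < m) (m<s : m < s) where

  private
    P≤ : Decreasing (spider a m)
    P≤ = spider-decreasing (<⇒≤ a<m)
    G : Graph (suc s)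
    G = treeGraph (spider a m) P≤ (suc s)
    open Graph G using (_~_)

    a≤s : a ≤ s
    a≤s = <⇒≤ (<-trans a<m m<s)

    child-cases : ∀ {i j} → Child (spider a m) i j → i ≡ suc j ⊎ (i ≡ suc m × j ≡ a)
    child-cases {suc w} {j} c with w ≟ m | child⁻ {spider a m} {w} {j} c
    ... | yes refl | eq = inj₂ (refl , trans (sym eq) (spider-≡ a m))
    ... | no  w≢m  | eq = inj₁ (cong suc (trans (sym (spider-≢ a w≢m)) eq))

    lower : ∀ {i} → suc i ≤ s → i ≤ s
    lower = <⇒≤

    nextTo : ∀ {i j} (i≤s : i ≤ s) (j≤s : j ≤ s) → Child (spider a m) i j → label P≤ j≤s ~ label P≤ i≤s
    nextTo {i} {j} i≤s j≤s c = adjacent-labels P≤ s j≤s i≤s (adjacentʳ {spider a m} {j} {i} c)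

    label-≢ : ∀ {i j} (i≤s : i ≤ s) (j≤s : j ≤ s) → i ≢ j → label P≤ i≤s ≢ label P≤ j≤s
    label-≢ i≤s j≤s i≢j eq = i≢j (trans (sym (toℕ-label P≤ i≤s)) (trans (cong toℕ eq) (toℕ-label P≤ j≤s)))

  centre : Fin (suc s)
  centre = label P≤ a≤s

  centre-branching : Branching G centre
  centre-branching = go a refl 0<a
    where
    go : ∀ i → i ≡ a → 0 < i → Branching G centre
    -- The neighbours are a - 1, a + 1 and `suc m`. As `a` is a module parameter, an equal variable
    -- is split to obtain a - 1.
    go (suc i) refl _ = label P≤ (lower a≤s) , label P≤ (≤-trans a<m (<⇒≤ m<s)) , label P≤ m<s ,
      label-≢ (lower a≤s) (≤-trans a<m (<⇒≤ m<s)) (<⇒≢ (m<n⇒m<1+n ≤-refl)) ,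
      label-≢ (lower a≤s) m<s (<⇒≢ (<-trans ≤-refl (m<n⇒m<1+n a<m))) ,
      label-≢ (≤-trans a<m (<⇒≤ m<s)) m<s (<⇒≢ (s≤s a<m)) ,
      Graph.~-sym G {label P≤ (lower a≤s)} {centre} (nextTo a≤s (lower a≤s) (spider-step a (<⇒≢ (<-trans ≤-refl a<m)))) ,
      nextTo (≤-trans a<m (<⇒≤ m<s)) a≤s (spider-step a (<⇒≢ a<m)) ,
      nextTo m<s a≤s (spider-branch a m)

  branching⇒centre : ∀ {x} → Branching G x → toℕ x ≡ a
  branching⇒centre {x} x-branching = decidable-stable (toℕ x ≟ a) λ x≢a →
    notBranching P≤ s (onlyChild x≢a) x-branching
    where
    onlyChild : toℕ x ≢ a → ∀ w → spider a m w ≡ toℕ x → w ≡ toℕ x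
    onlyChild x≢a w eq with w ≟ m
    ... | yes refl = contradiction (trans (sym eq) (spider-≡ a m)) x≢a
    ... | no  w≢m  = trans (sym (spider-≢ a w≢m)) eq

  -- Coming from the label above and unable to turn back, the ray can only descend to the leaf 0.
  innerRay-length : ∀ {u v ℓ} → Ray G u v ℓ → toℕ u ≡ suc (toℕ v) → toℕ v < a → ℓ ≡ toℕ v
  innerRay-length {u} {zero} (stop only) u≡ v<a = refl
  innerRay-length {u} {suc v} (stop only) u≡ v<a = contradiction
    (trans (sym toℕp) (trans (cong toℕ (only {p} v~p)) u≡)) (<⇒≢ (m<n⇒m<1+n ≤-refl))
    where
    v≤s : toℕ v ≤ s
    v≤s = <⇒≤ (toℕ<n v)
    p : Fin (suc s)
    p = label P≤ v≤s
    toℕp : toℕ p ≡ toℕ v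
    toℕp = toℕ-label P≤ v≤s
    v~p : suc v ~ p
    v~p = adjacentˡ {spider a m} {suc (toℕ v)} {toℕ p}
      (subst (Child (spider a m) (suc (toℕ v))) (sym toℕp)
        (spider-step a (<⇒≢ (<-trans (<-trans ≤-refl v<a) a<m))))
  innerRay-length {u} {v} (step {w = w} v~w w≢u ray) u≡ v<a
    with adjacent⁻ {spider a m} {toℕ v} {toℕ w} v~w
  ... | inj₁ v↓w with child-cases {toℕ v} v↓w
  ...   | inj₁ eq = trans (cong suc (innerRay-length ray eq (≤-trans (≤-reflexive (sym eq)) (<⇒≤ v<a)))) (sym eq)
  ...   | inj₂ (eq , _) = contradiction v<a (<⇒≯ (≤-trans a<m (≤-trans (n≤1+n m) (≤-reflexive (sym eq)))))
  innerRay-length {u} {v} (step {w = w} v~w w≢u ray) u≡ v<a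
      | inj₂ w↓v with child-cases {toℕ w} w↓v
  ...   | inj₁ eq = contradiction (toℕ-injective (trans eq (sym u≡))) w≢u
  ...   | inj₂ (_ , eq) = contradiction eq (<⇒≢ v<a)

  -- hi is the label of the leaf that ends the leg containing v: m or s.
  outerRay-length : ∀ {hi} → hi ≤ s → hi ≡ m ⊎ hi ≡ s → ∀ {u v ℓ} → Ray G u v ℓ →
    Child (spider a m) (toℕ v) (toℕ u) → a < toℕ v → toℕ v ≤ hi →
    (∀ {j} → toℕ v ≤ j → j < hi → j ≢ m) → toℕ v + ℓ ≡ hi
  outerRay-length {hi} hi≤s hi≡ {u} {v} (stop only) v↓u a<v v≤hi noBranch with m≤n⇒m<n∨m≡n v≤hi
  ... | inj₂ v≡hi = trans (+-identityʳ _) v≡hi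
  ... | inj₁ v<hi = contradiction (trans (sym (cong toℕ (only {w} v~w))) toℕw)
          (<⇒≢ (m<n⇒m<1+n (child-< P≤ {toℕ v} v↓u)))
    where
    v<s : toℕ v < s
    v<s = ≤-trans v<hi hi≤s
    w : Fin (suc s)
    w = label P≤ v<s
    toℕw : toℕ w ≡ suc (toℕ v)
    toℕw = toℕ-label P≤ v<s
    v~w : v ~ w
    v~w = adjacentʳ {spider a m} {toℕ v} {toℕ w}
      (subst (λ i → Child (spider a m) i (toℕ v)) (sym toℕw) (spider-step a (noBranch ≤-refl v<hi)))
  outerRay-length {hi} hi≤s hi≡ {u} {v} (step {w = w} {ℓ = ℓ} v~w w≢u ray) v↓u a<v v≤hi noBranch
    with adjacent⁻ {spider a m} {toℕ v} {toℕ w} v~w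
  ... | inj₁ v↓w = contradiction (toℕ-injective (child-unique P≤ s {toℕ v} v↓w v↓u)) w≢u
  ... | inj₂ w↓v with child-cases {toℕ w} w↓v
  ...   | inj₂ (_ , eq) = contradiction eq (>⇒≢ a<v)
  ...   | inj₁ eq = trans (+-suc (toℕ v) ℓ) (trans (cong (_+ ℓ) (sym eq))
            (outerRay-length hi≤s hi≡ ray w↓v (≤-trans a<v v≤w) w≤hi (noBranch ∘ ≤-trans v≤w)))
    where
    v≤w : toℕ v ≤ toℕ w
    v≤w = ≤-trans (n≤1+n _) (≤-reflexive (sym eq))
    -- The leaf `hi` has no child `suc hi`: for `s` that label is out of range, and the parent of
    -- `suc m` is `a`.
    v≢hi : hi ≡ m ⊎ hi ≡ s → toℕ v ≢ hi
    v≢hi (inj₂ hi≡s) v≡hi =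
      <⇒≱ (toℕ<n w) (≤-reflexive (trans (cong suc (sym (trans v≡hi hi≡s))) (sym eq)))
    v≢hi (inj₁ hi≡m) v≡hi = <⇒≢ a<m (trans (sym (spider-≡ a m)) (trans
      (child⁻ {spider a m} {m} (subst (λ i → Child (spider a m) i (toℕ v)) (trans eq (cong suc v≡m)) w↓v)) v≡m))
      where
      v≡m : toℕ v ≡ m
      v≡m = trans v≡hi hi≡m
    w≤hi : toℕ w ≤ hi
    w≤hi = ≤-trans (≤-reflexive eq) (≤∧≢⇒< v≤hi (v≢hi hi≡))

  -- The centre is the only branching vertex, and the first step to a - 1, a + 1 or `suc m`
  -- determines the rest of the walk.
  leg-lengths : ∀ {ℓ} → Leg G ℓ → ℓ ≡ a ⊎ a + ℓ ≡ m ⊎ m + ℓ ≡ s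
  leg-lengths (z , v , z-branching , z~v , k , refl , ray)
    with adjacent⁻ {spider a m} {toℕ z} {toℕ v} z~v | branching⇒centre z-branching
  ... | inj₁ z↓v | z≡a with child-cases {toℕ z} z↓v
  ...   | inj₁ eq = inj₁ (trans (cong suc (innerRay-length ray eq
            (≤-reflexive (trans (sym eq) z≡a)))) (trans (sym eq) z≡a))
  ...   | inj₂ (eq , _) = contradiction (trans (sym z≡a) eq) (<⇒≢ (m<n⇒m<1+n a<m))
  leg-lengths (z , v , z-branching , z~v , k , refl , ray)
      | inj₂ v↓z | z≡a with child-cases {toℕ v} v↓z
  ...   | inj₁ eq = inj₂ (inj₁ (trans (+-suc a k) (trans (cong (λ i → suc i + k) (sym z≡a))
            (trans (cong (_+ k) (sym eq)) (outerRay-length (<⇒≤ m<s) (inj₁ refl) ray v↓z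
              (≤-reflexive (sym v≡)) (≤-trans (≤-reflexive v≡) a<m) (λ _ → <⇒≢))))))
    where
    v≡ : toℕ v ≡ suc a
    v≡ = trans eq (cong suc z≡a)
  ...   | inj₂ (eq , _) = inj₂ (inj₂ (trans (+-suc m k) (trans (cong (_+ k) (sym eq))
            (outerRay-length ≤-refl (inj₂ refl) ray v↓z
              (≤-trans (m<n⇒m<1+n a<m) (≤-reflexive (sym eq))) (≤-pred (toℕ<n v))
              (λ v≤j _ → >⇒≢ (≤-trans (≤-reflexive (sym eq)) v≤j))))))

  innerRay : ∀ j {u v} → toℕ u ≡ suc j → toℕ v ≡ j → j < a → Ray G u v j
  innerRay zero {u} {v} u≡ v≡ 0<a = stop λ {w} v~w → case adjacent⁻ {spider a m} {toℕ v} {toℕ w} v~w of λ where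
    (inj₁ v↓w) → contradiction (≤-trans (child-< P≤ {toℕ v} v↓w) (≤-reflexive v≡)) λ ()
    (inj₂ w↓v) → case child-cases {toℕ w} w↓v of λ where
      (inj₁ eq) → toℕ-injective (trans eq (trans (cong suc v≡) (sym u≡)))
      (inj₂ (_ , eq)) → contradiction (trans (sym v≡) eq) (<⇒≢ 0<a)
  innerRay (suc j) {u} {v} u≡ v≡ j<a = step {w = w}
    (adjacentˡ {spider a m} {toℕ v} {toℕ w} (subst₂ (Child (spider a m)) (sym v≡) (sym w≡)
      (spider-step a (<⇒≢ (<-trans (<-trans ≤-refl j<a) a<m)))))
    (λ eq → <⇒≢ (m<n⇒m<1+n ≤-refl) (trans (sym w≡) (trans (cong toℕ eq) u≡)))
    (innerRay j v≡ w≡ (<⇒≤ j<a))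
    where
    j≤s : j ≤ s
    j≤s = ≤-trans (≤-trans (n≤1+n j) (<⇒≤ j<a)) a≤s
    w : Fin (suc s)
    w = label P≤ j≤s
    w≡ : toℕ w ≡ j
    w≡ = toℕ-label P≤ j≤s

  outerRay : ∀ d {u v} → toℕ v + d ≡ s → m < toℕ v → Child (spider a m) (toℕ v) (toℕ u) → Ray G u v d
  outerRay zero {u} {v} v≡ m<v v↓u = stop λ {w} v~w → case adjacent⁻ {spider a m} {toℕ v} {toℕ w} v~w of λ where
    (inj₁ v↓w) → toℕ-injective (child-unique P≤ s {toℕ v} v↓w v↓u)
    (inj₂ w↓v) → contradiction (child-< P≤ {toℕ w} w↓v)
      (≤⇒≯ (≤-trans (≤-pred (toℕ<n w)) (≤-reflexive (trans (sym v≡) (+-identityʳ _)))))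
  outerRay (suc d) {u} {v} v≡ m<v v↓u = step {w = w}
    (adjacentʳ {spider a m} {toℕ v} {toℕ w} w↓v)
    (λ eq → <⇒≢ (m<n⇒m<1+n (child-< P≤ {toℕ v} v↓u)) (trans (cong toℕ (sym eq)) w≡))
    (outerRay d (trans (cong (_+ d) w≡) (trans (sym (+-suc (toℕ v) d)) v≡))
      (≤-trans (m<n⇒m<1+n m<v) (≤-reflexive (sym w≡))) w↓v)
    where
    v<s : toℕ v < s
    v<s = ≤-trans (m<m+n (toℕ v) (s≤s z≤n)) (≤-reflexive v≡)
    w : Fin (suc s)
    w = label P≤ v<s
    w≡ : toℕ w ≡ suc (toℕ v)
    w≡ = toℕ-label P≤ v<s
    w↓v : Child (spider a m) (toℕ w) (toℕ v)
    w↓v = subst (λ i → Child (spider a m) i (toℕ v)) (sym w≡) (spider-step a (>⇒≢ m<v))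

  -- For a spider given by a `Code`, this leg is a shortest one and the one of `outerLeg` a longest;
  -- no others are needed to compare spiders.
  innerLeg : Leg G a
  innerLeg = go a refl 0<a
    where
    go : ∀ i → i ≡ a → 0 < i → Leg G i
    go (suc i) refl _ = centre , label P≤ (lower a≤s) , centre-branching ,
      Graph.~-sym G {label P≤ (lower a≤s)} {centre} (nextTo a≤s (lower a≤s) (spider-step a (<⇒≢ (<-trans ≤-refl a<m)))) ,
      i , refl , innerRay i (toℕ-label P≤ a≤s) (toℕ-label P≤ (lower a≤s)) ≤-refl

  outerLeg : ∀ {ℓ} → m + ℓ ≡ s → Leg G ℓ
  outerLeg {zero}  eq = contradiction (trans (sym (+-identityʳ m)) eq) (<⇒≢ m<s)
  outerLeg {suc k} eq = centre , label P≤ m<s , centre-branching , nextTo m<s a≤s (spider-branch a m) ,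
    k , refl , outerRay k (trans (cong (_+ k) m≡) (trans (sym (+-suc m k)) eq)) (≤-reflexive (sym m≡))
      (subst₂ (Child (spider a m)) (sym m≡) (sym (toℕ-label P≤ a≤s)) (spider-branch a m))
    where
    m≡ : toℕ (label P≤ m<s) ≡ suc m
    m≡ = toℕ-label P≤ m<s

-- Spiders spanning the vertices of a minimal tree

-- `to` maps the new labels to the old ones, so that an embedding is relabelled by composing with
-- it. `to-edge` asks for adjacency only, since parent and child may change roles.
record Relabelling (P : ℕ → ℕ) (k : ℕ) (Q : ℕ → ℕ) (l : ℕ) : Set where
  field
    to from   : ℕ → ℕ
    to-<      : ∀ {i} → i < l → to i < k
    from-<    : ∀ {j} → j < k → from j < l
    from-to   : ∀ {i} → i < l → from (to i) ≡ i
    to-from   : ∀ {j} → j < k → to (from j) ≡ j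
    to-edge   : ∀ {w} → suc w < l → Adjacent P (to (suc w)) (to (Q w))

open Relabelling

flip : ℕ → ℕ → ℕ
flip m v with v ≤? m
... | yes _ = m ∸ v
... | no  _ = v

flip-≤ : ∀ {m v} → v ≤ m → flip m v ≡ m ∸ v
flip-≤ {m} {v} v≤m with v ≤? m
... | yes _   = refl
... | no  v≰m = contradiction v≤m v≰m

flip-> : ∀ {m v} → m < v → flip m v ≡ v
flip-> {m} {v} m<v with v ≤? m
... | yes v≤m = contradiction m<v (≤⇒≯ v≤m)
... | no  _   = refl

flip-involutive : ∀ m v → flip m (flip m v) ≡ v
flip-involutive m v with v ≤? m
... | yes v≤m = trans (flip-≤ (m∸n≤m m v)) (m∸[m∸n]≡n v≤m)
... | no  v≰m = flip-> (≰⇒> v≰m)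

flip-< : ∀ {m k v} → m < k → v < k → flip m v < k
flip-< {m} {k} {v} m<k v<k with v ≤? m
... | yes _ = ≤-trans (s≤s (m∸n≤m m v)) m<k
... | no  _ = v<k

-- Reading the path 0, ..., `m` backwards moves the centre from `a` to m - a; the third leg keeps
-- its labels.
swapFirstLegs : ∀ {a m k} → a ≤ m → m < k → Relabelling (spider a m) k (spider (m ∸ a) m) k
swapFirstLegs {a} {m} {k} a≤m m<k = record
  { to = flip m ; from = flip m ; to-< = flip-< m<k ; from-< = flip-< m<k
  ; from-to = λ _ → flip-involutive m _ ; to-from = λ _ → flip-involutive m _ ; to-edge = edge′ _
  }
  where
  edge′ : ∀ w → suc w < k → Adjacent (spider a m) (flip m (suc w)) (flip m (spider (m ∸ a) m w))
  edge′ w w<k with <-cmp w m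
  ... | tri< w<m w≢m _ = subst₂ (Adjacent (spider a m)) (sym (flip-≤ w<m))
    (trans (sym (∸-suc w<m)) (trans (sym (flip-≤ (<⇒≤ w<m))) (cong (flip m) (sym (spider-≢ (m ∸ a) w≢m)))))
    (adjacentʳ {spider a m} {m ∸ suc w} {suc (m ∸ suc w)}
      (spider-step a (<⇒≢ (≤-trans (≤-reflexive (sym (∸-suc w<m))) (m∸n≤m m w)))))
    where
    ∸-suc : ∀ {m w} → w < m → m ∸ w ≡ suc (m ∸ suc w)
    ∸-suc {suc m} {zero}  _         = refl
    ∸-suc {suc m} {suc w} (s≤s w<m) = ∸-suc w<m
  ... | tri≈ _ refl _ = subst₂ (Adjacent (spider a m)) (sym (flip-> ≤-refl))
    (trans (sym (m∸[m∸n]≡n a≤m)) (trans (sym (flip-≤ (m∸n≤m m a)))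
      (cong (flip m) (sym (spider-≡ (m ∸ a) m)))))
    (adjacentˡ {spider a m} {suc m} {a} (spider-branch a m))
  ... | tri> _ w≢m m<w = subst₂ (Adjacent (spider a m)) (sym (flip-> (m<n⇒m<1+n m<w)))
    (trans (sym (flip-> m<w)) (cong (flip m) (sym (spider-≢ (m ∸ a) w≢m))))
    (adjacentˡ {spider a m} {suc w} {w} (spider-step a w≢m))

-- The three blocks are the first leg with the centre, the second leg of length `c`, and the third
-- leg.
data Block (a c : ℕ) : ℕ → Set where
  low  : ∀ {v} → v ≤ a → Block a c v
  mid  : ∀ {i} → i < c → Block a c (a + suc i)
  high : ∀ i → Block a c (a + c + suc i)

block : ∀ a c v → Block a c v
block a c v with v ≤? a | v ≤? a + c
... | yes v≤a | _ = low v≤a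
... | no v≰a | yes v≤a+c = subst (Block a c) eq
        (mid (+-cancelˡ-≤ a _ _ (≤-trans (≤-reflexive eq) v≤a+c)))
  where
  eq : a + suc (v ∸ suc a) ≡ v
  eq = trans (+-suc a _) (m+[n∸m]≡n (≰⇒> v≰a))
... | no _ | no v≰a+c = subst (Block a c)
        (trans (+-suc (a + c) _) (m+[n∸m]≡n (≰⇒> v≰a+c))) (high (v ∸ suc (a + c)))

-- From labels for legs `a`, `c`, `b` to labels for legs `a`, `b`, `c`: two consecutive blocks of
-- lengths `c` and `b` trade places.
exchange : ℕ → ℕ → ℕ → ℕ → ℕ
exchange a b c v with v ≤? a | v ≤? a + c
... | yes _ | _     = v
... | no  _ | yes _ = v + b
... | no  _ | no  _ = v ∸ c

module _ (a b c : ℕ) where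

  exchange-low : ∀ {v} → v ≤ a → exchange a b c v ≡ v
  exchange-low {v} v≤a with v ≤? a
  ... | yes _   = refl
  ... | no  v≰a = contradiction v≤a v≰a

  exchange-mid : ∀ {i} → i < c → exchange a b c (a + suc i) ≡ a + b + suc i
  exchange-mid {i} i<c with a + suc i ≤? a | a + suc i ≤? a + c
  ... | yes ≤a | _      = contradiction ≤a (m+1+n≰m a)
  ... | no  _  | yes _  = trans (+-assoc a (suc i) b)
    (trans (cong (a +_) (+-comm (suc i) b)) (sym (+-assoc a b (suc i))))
  ... | no  _  | no  ≰c = contradiction (+-monoʳ-≤ a i<c) ≰c

  exchange-high : ∀ i → exchange a b c (a + c + suc i) ≡ a + suc i
  exchange-high i with a + c + suc i ≤? a | a + c + suc i ≤? a + c
  ... | yes ≤a | _       = contradiction (≤-trans (≤-trans (s≤s (m≤m+n a c)) (m<m+n (a + c) (s≤s z≤n))) ≤a) (<⇒≱ ≤-refl)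
  ... | no  _  | yes ≤ac = contradiction ≤ac (m+1+n≰m (a + c))
  ... | no  _  | no  _   = trans (cong (_∸ c) (trans (+-assoc a c (suc i))
    (trans (cong (a +_) (+-comm c (suc i))) (sym (+-assoc a (suc i) c))))) (m+n∸n≡m (a + suc i) c)

exchange-< : ∀ a b c {v} → v < suc (a + c + b) → exchange a b c v < suc (a + b + c)
exchange-< a b c {v} v< with block a c v
... | low v≤a = s≤s (≤-trans (≤-reflexive (exchange-low a b c v≤a))
        (≤-trans v≤a (≤-trans (m≤m+n a b) (m≤m+n (a + b) c))))
... | mid i<c = s≤s (≤-trans (≤-reflexive (exchange-mid a b c i<c)) (+-monoʳ-≤ (a + b) i<c))
... | high i  = s≤s (≤-trans (≤-reflexive (exchange-high a b c i))
        (≤-trans (+-monoʳ-≤ a (+-cancelˡ-≤ (a + c) (suc i) b (≤-pred v<))) (m≤m+n (a + b) c)))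

exchange-inverse : ∀ a b c {v} → v < suc (a + c + b) → exchange a c b (exchange a b c v) ≡ v
exchange-inverse a b c {v} v< with block a c v
... | low v≤a = trans (cong (exchange a c b) (exchange-low a b c v≤a)) (exchange-low a c b v≤a)
... | mid i<c = trans (cong (exchange a c b) (exchange-mid a b c i<c)) (exchange-high a c b _)
... | high i  = trans (cong (exchange a c b) (exchange-high a b c i))
        (exchange-mid a c b (+-cancelˡ-≤ (a + c) (suc i) b (≤-pred v<)))

swapLastLegs : ∀ {a b c} → 0 < b → 0 < c →
               Relabelling (spider a (a + b)) (suc (a + b + c)) (spider a (a + c)) (suc (a + c + b))
swapLastLegs {a} {b} {c} 0<b 0<c = record
  { to = exchange a b c ; from = exchange a c b
  ; to-< = exchange-< a b c ; from-< = exchange-< a c b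
  ; from-to = exchange-inverse a b c ; to-from = exchange-inverse a c b ; to-edge = edge′ _
  }
  where
  σ : ℕ → ℕ
  σ = exchange a b c
  P Q : ℕ → ℕ
  P = spider a (a + b)
  Q = spider a (a + c)

  link : ∀ w {z u v} → Child P u v → σ (suc w) ≡ u → Q w ≡ z → σ z ≡ v →
         Adjacent P (σ (suc w)) (σ (Q w))
  link w {u = u} {v} u↓v σx≡u Qy≡z σz≡v = subst₂ (Adjacent P) (sym σx≡u)
    (sym (trans (cong σ Qy≡z) σz≡v)) (adjacentˡ {P} {u} {v} u↓v)

  a≢a+ : ∀ {d} → 0 < d → a ≢ a + d
  a≢a+ 0<d = <⇒≢ (m<m+n a 0<d)

  edge′ : ∀ w → suc w < suc (a + c + b) → Adjacent P (σ (suc w)) (σ (Q w))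
  edge′ w w< with block a c w
  ... | low w≤a with m≤n⇒m<n∨m≡n w≤a
  ...   | inj₁ w<a = link w (spider-step a (<⇒≢ (≤-trans w<a (m≤m+n a b)))) (exchange-low a b c w<a)
            (spider-≢ a (<⇒≢ (≤-trans w<a (m≤m+n a c)))) (exchange-low a b c w≤a)
  -- The start of the second leg becomes the start of the third, which is attached by the branch
  -- edge.
  ...   | inj₂ refl = link w (spider-branch a (a + b))
            (trans (cong σ (+-comm 1 a)) (trans (exchange-mid a b c 0<c) (+-comm (a + b) 1)))
            (spider-≢ a (a≢a+ 0<c)) (exchange-low a b c ≤-refl)
  edge′ w w< | mid {i} i<c with m≤n⇒m<n∨m≡n i<c
  ...   | inj₁ i+1<c = link (a + suc i) (spider-step a (m+1+n≢m (a + b)))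
            (trans (cong σ (sym (+-suc a (suc i)))) (trans (exchange-mid a b c i+1<c) (+-suc (a + b) (suc i))))
            (spider-≢ a (<⇒≢ (+-monoʳ-< a i+1<c))) (exchange-mid a b c i<c)
  -- Conversely, the branch edge becomes the path edge between `a` and `suc a`.
  ...   | inj₂ refl = link (a + suc i) (spider-step a (a≢a+ 0<b))
            (trans (cong σ (+-comm 1 (a + c))) (trans (exchange-high a b c 0) (+-comm a 1)))
            (spider-≡ a (a + c)) (exchange-low a b c ≤-refl)
  edge′ w w< | high i = link (a + c + suc i)
            (spider-step a (<⇒≢ (+-monoʳ-< a (+-cancelˡ-< (a + c) (suc i) b (≤-pred w<)))))
            (trans (cong σ (sym (+-suc (a + c) (suc i)))) (trans (exchange-high a b c (suc i)) (+-suc a (suc i))))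
            (spider-≢ a (m+1+n≢m (a + c))) (exchange-high a b c i)

module _ {n : ℕ} (G : Graph n) where
  open Graph G

  relabel : ∀ {P k Q l f} (r : Relabelling P k Q l) → Decreasing Q → Embeds _~_ P k f → Embeds _~_ Q l (f ∘ to r)
  relabel r Q≤ e .injective i<l j<l eq = trans (sym (from-to r i<l)) (trans
    (cong (from r) (e .injective (to-< r i<l) (to-< r j<l) eq)) (from-to r j<l))
  relabel {Q = Q} r Q≤ e .edge {w} w<l = embeds-preserves G e (to-< r w<l)
    (to-< r (≤-trans (s≤s (Q≤ w)) (<⇒≤ w<l))) (to-edge r w<l)

  relabel-image : ∀ {P k Q l} {f : ℕ → Fin n} (r : Relabelling P k Q l) → ∀ {x} →
                  Image k f x → Image l (f ∘ to r) x
  relabel-image {f = f} r (j , j<k , eq) = from r j , from-< r j<k , trans (cong f (to-from r j<k)) eq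

  grow-image : ∀ {k v} {f : ℕ → Fin n} {x} → Image k f x → Image (suc k) (f [ k ↦ v ]) x
  grow-image {k} {v} {f} (j , j<k , eq) = j , m<n⇒m<1+n j<k , trans (update-< f v j<k) eq

  -- Otherwise `u` and `w` would form a module with two elements, which is nontrivial among at least
  -- four vertices.
  distinguish : IsPrime G → ∀ {u w} → u ≢ w →
                ∃ λ v → v ≢ u × v ≢ w × (v ~ u × ¬ v ~ w ⊎ v ~ w × ¬ v ~ u)
  distinguish (4≤n , trivial) {u} {w} u≢w
    with any? (λ v → ¬? (v ≟F u) ×-dec ¬? (v ≟F w) ×-dec
                     ((T? (adj v u) ×-dec ¬? (T? (adj v w))) ⊎-dec (T? (adj v w) ×-dec ¬? (T? (adj v u)))))
  ... | yes found = found
  ... | no  none  = contradiction (trivial M M-module) nontrivial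
    where
    M : Subset n
    M = ⁅ u ⁆ ∪ ⁅ w ⁆
    u∈M : u ∈ M
    u∈M = x∈p∪q⁺ (inj₁ (x∈⁅x⁆ u))
    w∈M : w ∈ M
    w∈M = x∈p∪q⁺ {p = ⁅ u ⁆} (inj₂ (x∈⁅x⁆ w))
    both : {Q : Fin n → Set} → Q u → Q w → ∀ x → x ∈ M → Q x
    both {Q} Qu Qw x x∈M with x∈p∪q⁻ ⁅ u ⁆ ⁅ w ⁆ x∈M
    ... | inj₁ x∈u = subst Q (sym (x∈⁅y⁆⇒x≡y u x∈u)) Qu
    ... | inj₂ x∈w = subst Q (sym (x∈⁅y⁆⇒x≡y w x∈w)) Qw
    M-module : IsModule G M
    M-module v v∉M with T? (adj v u) | T? (adj v w)
    ... | yes v~u | yes v~w = inj₁ (both v~u v~w)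
    ... | no  v≁u | no  v≁w = inj₂ (both v≁u v≁w)
    ... | yes v~u | no  v≁w = contradiction
      (v , (λ { refl → v∉M u∈M }) , (λ { refl → v∉M w∈M }) , inj₁ (v~u , v≁w)) none
    ... | no  v≁u | yes v~w = contradiction
      (v , (λ { refl → v∉M u∈M }) , (λ { refl → v∉M w∈M }) , inj₂ (v~w , v≁u)) none
    nontrivial : ¬ IsTrivial G M
    nontrivial (inj₁ M≡∅) = ∉⊥ (subst (u ∈_) M≡∅ u∈M)
    nontrivial (inj₂ (inj₁ (x , M≡x))) = u≢w
      (trans (x∈⁅y⁆⇒x≡y x (subst (u ∈_) M≡x u∈M)) (sym (x∈⁅y⁆⇒x≡y x (subst (w ∈_) M≡x w∈M))))
    nontrivial (inj₂ (inj₂ M≡⊤)) = <⇒≱ (s≤s (s≤s (s≤s z≤n))) (≤-trans 4≤n (≤-reflexive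
      (trans (sym (∣⊤∣≡n n)) (trans (cong ∣_∣ (sym M≡⊤))
        (trans (∣⁅x⁆∪p∣ u ⁅ w ⁆ (u≢w ∘ x∈⁅y⁆⇒x≡y w)) (cong suc (∣⁅x⁆∣≡1 w)))))))

  -- A third leg that starts at the end of the path merely continues it.
  spider⇒path : ∀ {m k f} → Embeds _~_ (spider m m) k f → Embeds _~_ id k f
  spider⇒path {m} = reparent λ {w} _ → spider-self w
    where
    spider-self : ∀ w → spider m m w ≡ w
    spider-self w with w ≟ m
    ... | yes refl = spider-≡ m m
    ... | no  w≢m  = spider-≢ m w≢m

  path⇒spider : ∀ {a m f} → Embeds _~_ id (suc m) f → Embeds _~_ (spider a m) (suc m) f
  path⇒spider {a} = reparent λ w<m → sym (spider-≢ a (<⇒≢ (≤-pred w<m)))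

  -- `X` is a predicate because it first stands for two elements of the minimal set and later for
  -- membership in all of it.
  record Spanned (P : ℕ → ℕ) (k : ℕ) (X : Fin n → Set) : Set where
    constructor spanned
    field
      {f}    : ℕ → Fin n
      embeds : Embeds _~_ P k f
      covers : ∀ {x} → X x → Image k f x

  module _ {X : Fin n → Set} where

    relabelSpanned : ∀ {P k Q l} → Relabelling P k Q l → Decreasing Q → Spanned P k X → Spanned Q l X
    relabelSpanned r Q≤ (spanned e covers) = spanned (relabel r Q≤ e) (relabel-image r ∘ covers)

    growSpanned : ∀ {P w f v} → Decreasing P → Embeds _~_ P (suc w) f → (∀ {x} → X x → Image (suc w) f x) →
                  ¬ Image (suc w) f v → v ~ f (P w) → Spanned P (suc (suc w)) X
    growSpanned P≤ e covers v∉ v~ =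
      spanned (grow P≤ e (λ j≤w eq → v∉ (_ , s≤s j≤w , eq)) v~) (grow-image ∘ covers)

    -- A vertex distinguishing the two ends is new, as the only other path vertex there can be is
    -- adjacent to both. It prolongs the path at one end.
    longerPath : IsPrime G → ∀ {m} → m ≡ 1 ⊎ m ≡ 2 → Spanned id (suc m) X → Spanned id (suc (suc m)) X
    longerPath prime {m} m≡ (spanned {f} e covers)
      with distinguish prime {f 0} {f m} (λ eq → <⇒≢ (0<m m≡) (e .injective (s≤s z≤n) ≤-refl eq))
      where
      0<m : m ≡ 1 ⊎ m ≡ 2 → 0 < m
      0<m (inj₁ refl) = s≤s z≤n
      0<m (inj₂ refl) = s≤s z≤n
    ... | v , v≢0 , v≢m , sees = extend sees
      where
      middle : ∀ j → j < suc m → m ≡ 1 ⊎ m ≡ 2 → j ≢ 0 → j ≢ m → f j ~ f 0 × f j ~ f m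
      middle 0 _ _ j≢0 _ = contradiction refl j≢0
      middle 1 _ (inj₁ refl) _ j≢m = contradiction refl j≢m
      middle 1 _ (inj₂ refl) _ _ = e .edge (s≤s (s≤s z≤n)) , ~-sym (e .edge ≤-refl)
      middle 2 _ (inj₂ refl) _ j≢m = contradiction refl j≢m
      middle (suc (suc j)) (s≤s (s≤s ())) (inj₁ refl) _ _
      middle (suc (suc (suc j))) (s≤s (s≤s (s≤s ()))) (inj₂ refl) _ _

      fresh : ¬ (v ~ f 0 × v ~ f m) → ¬ Image (suc m) f v
      fresh ¬both (j , j< , refl) = ¬both (middle j j< m≡ (λ { refl → v≢0 refl }) (λ { refl → v≢m refl }))

      reversal : Relabelling (spider 0 m) (suc m) (spider m m) (suc m)
      reversal = swapFirstLegs z≤n ≤-refl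

      extend : v ~ f 0 × ¬ v ~ f m ⊎ v ~ f m × ¬ v ~ f 0 → Spanned id (suc (suc m)) X
      extend (inj₂ (v~m , v≁0)) = growSpanned id-decreasing e covers (fresh (v≁0 ∘ proj₁)) v~m
      -- New vertices are added after the last label, so the path is reversed first.
      extend (inj₁ (v~0 , v≁m)) = growSpanned id-decreasing
        (spider⇒path (relabel reversal (spider-decreasing ≤-refl) (path⇒spider e)))
        (relabel-image reversal ∘ covers)
        (λ (j , j< , eq) → fresh (v≁m ∘ proj₂) (to reversal j , to-< reversal j< , eq))
        (subst (λ i → v ~ f i) (sym (trans (flip-≤ {m} {m} ≤-refl) (n∸n≡0 m))) v~0)

    longPath : IsPrime G → ∀ {m} → Spanned id (suc (suc m)) X → ∃ λ m → 3 ≤ m × Spanned id (suc m) X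
    longPath prime {0} sp = 3 , ≤-refl , longerPath prime (inj₂ refl) (longerPath prime (inj₁ refl) sp)
    longPath prime {1} sp = 3 , ≤-refl , longerPath prime (inj₂ refl) sp
    longPath prime {suc (suc m)} sp = suc (suc (suc m)) , s≤s (s≤s (s≤s z≤n)) , sp

    SpannedSpider : ℕ → ℕ → ℕ → Set
    SpannedSpider a b c = Spanned (spider a (a + b)) (suc (a + b + c)) X

    swap₁₂ : ∀ {a b c} → SpannedSpider a b c → SpannedSpider b a c
    swap₁₂ {a} {b} {c} sp = subst (λ m → Spanned (spider b m) (suc (m + c)) X) (+-comm a b)
      (subst (λ d → Spanned (spider d (a + b)) (suc (a + b + c)) X) (m+n∸m≡n a b)
        (relabelSpanned (swapFirstLegs (m≤m+n a b) (s≤s (m≤m+n (a + b) c))) (spider-decreasing (m∸n≤m (a + b) a)) sp))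

    swap₂₃ : ∀ {a b c} → 0 < b → 0 < c → SpannedSpider a b c → SpannedSpider a c b
    swap₂₃ {a} {b} {c} 0<b 0<c = relabelSpanned (swapLastLegs 0<b 0<c) (spider-decreasing (m≤m+n a c))

    SortedSpider : ℕ → Set
    SortedSpider s = ∃₂ λ a b → ∃ λ c → 0 < a × a ≤ b × b ≤ c × a + b + c ≡ s × SpannedSpider a b c

    insertLeg : ∀ {a b c} → 0 < a → a ≤ b → 0 < c → SpannedSpider a b c → SortedSpider (a + b + c)
    insertLeg {a} {b} {c} 0<a a≤b 0<c sp with ≤-total b c
    ... | inj₁ b≤c = a , b , c , 0<a , a≤b , b≤c , refl , sp
    ... | inj₂ c≤b with ≤-total a c
    ...   | inj₁ a≤c = a , c , b , 0<a , a≤c , c≤b ,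
            trans (+-assoc a c b) (trans (cong (a +_) (+-comm c b)) (sym (+-assoc a b c))) ,
            swap₂₃ (≤-trans 0<a a≤b) 0<c sp
    ...   | inj₂ c≤a = c , a , b , 0<c , c≤a , a≤b , trans (+-assoc c a b) (+-comm c (a + b)) ,
            swap₁₂ (swap₂₃ (≤-trans 0<a a≤b) 0<c sp)

    sortLegs : ∀ {a b c} → 0 < a → 0 < b → 0 < c → SpannedSpider a b c → SortedSpider (a + b + c)
    sortLegs {a} {b} {c} 0<a 0<b 0<c sp with ≤-total a b
    ... | inj₁ a≤b = insertLeg 0<a a≤b 0<c sp
    ... | inj₂ b≤a = subst (λ m → SortedSpider (m + c)) (+-comm b a) (insertLeg 0<b b≤a 0<c (swap₁₂ sp))

    module _ (acyclic : ¬ HasCycle G) where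

      private
        -- Only the last leg can be prolonged directly, so the leg ending at label 2 is moved there,
        -- prolonged and moved back.
        lastTwin : ∀ {c f v} → 0 < c → Embeds _~_ (spider 1 2) (suc (2 + c)) f →
                   (∀ {x} → X x → Image (suc (2 + c)) f x) → ¬ Image (suc (2 + c)) f v → v ~ f 2 →
                   SpannedSpider 1 2 c
        lastTwin {c} {f} {v} 0<c e covers v∉ v~2 = swap₂₃ 0<c (s≤s z≤n)
          (subst (λ k → Spanned (spider 1 (1 + c)) k X) (cong suc (sym (+-suc (1 + c) 1)))
            (growSpanned (spider-decreasing (m≤m+n 1 c)) (relabel r (spider-decreasing (m≤m+n 1 c)) e)
              (relabel-image r ∘ covers)
              (λ (j , j< , eq) → v∉ (to r j , to-< r j< , eq))
              (subst (λ i → v ~ f i) (sym (trans (cong (to r) (spider-≢ 1 (m+1+n≢m (1 + c))))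
                (exchange-high 1 1 c 0))) v~2)))
          where
          r : Relabelling (spider 1 2) (suc (2 + c)) (spider 1 (1 + c)) (suc (1 + c + 1))
          r = swapLastLegs (s≤s z≤n) 0<c

      -- Labels 0 and 2 see only the centre within the spider, so the vertex that distinguishes them
      -- is new and prolongs one of their legs.
      extendTwin : IsPrime G → ∀ {c} → 0 < c → SpannedSpider 1 1 c → SpannedSpider 1 2 c
      extendTwin prime {c} 0<c (spanned {f} e covers)
        with distinguish prime {f 0} {f 2} (λ eq → case e .injective (s≤s z≤n) (s≤s (s≤s (s≤s z≤n))) eq of λ ())
      ... | v , v≢0 , v≢2 , sees = extend sees
        where
        sees1 : ∀ i → i ≡ 0 ⊎ i ≡ 2 → ∀ {j} → j < suc (2 + c) → f j ~ f i → j ≡ 1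
        sees1 i i≡ {j} j< j~i with adjacent⁻ {spider 1 2} {j} {i}
          (embeds-reflects G (spider-decreasing (s≤s z≤n)) acyclic e j< (bound i≡) j~i)
          where
          bound : i ≡ 0 ⊎ i ≡ 2 → i < suc (2 + c)
          bound (inj₁ refl) = s≤s z≤n
          bound (inj₂ refl) = s≤s (s≤s (s≤s z≤n))
        -- Splitting off small labels lets `spider 1 2` compute: no label but 1 is adjacent to 0 or
        -- to 2.
        sees1 i (inj₁ refl) {suc 0} _ _ | inj₁ _ = refl
        sees1 i (inj₁ refl) {suc 1} _ _ | inj₁ ()
        sees1 i (inj₁ refl) {suc 2} _ _ | inj₁ ()
        sees1 i (inj₁ refl) {suc (suc (suc (suc j)))} _ _ | inj₁ ()
        sees1 i (inj₂ refl) {suc 0} _ _ | inj₁ ()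
        sees1 i (inj₂ refl) {suc 1} _ _ | inj₁ ()
        sees1 i (inj₂ refl) {suc 2} _ _ | inj₁ ()
        sees1 i (inj₂ refl) {suc (suc (suc (suc j)))} _ _ | inj₁ ()
        sees1 i (inj₁ refl) _ _ | inj₂ ()
        sees1 i (inj₂ refl) {j} _ _ | inj₂ c = sym (≡ᵇ⇒≡ 1 j c)

        centre~ : f 1 ~ f 0 × f 1 ~ f 2
        centre~ = e .edge (s≤s (s≤s z≤n)) , ~-sym (e .edge (s≤s (s≤s (s≤s z≤n))))

        fresh : ¬ (v ~ f 0 × v ~ f 2) → v ~ f 0 ⊎ v ~ f 2 → ¬ Image (suc (2 + c)) f v
        fresh ¬both (inj₁ v~0) (j , j< , refl) with refl ← sees1 0 (inj₁ refl) j< v~0 = ¬both centre~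
        fresh ¬both (inj₂ v~2) (j , j< , refl) with refl ← sees1 2 (inj₂ refl) j< v~2 = ¬both centre~

        r : Relabelling (spider 1 2) (suc (2 + c)) (spider 1 2) (suc (2 + c))
        r = swapFirstLegs (s≤s z≤n) (s≤s (m≤m+n 2 c))

        extend : v ~ f 0 × ¬ v ~ f 2 ⊎ v ~ f 2 × ¬ v ~ f 0 → SpannedSpider 1 2 c
        extend (inj₂ (v~2 , v≁0)) = lastTwin 0<c e covers (fresh (v≁0 ∘ proj₁) (inj₂ v~2)) v~2
        -- Exchanging the first two legs turns label 0 into label 2.
        extend (inj₁ (v~0 , v≁2)) = lastTwin 0<c (relabel r (spider-decreasing (s≤s z≤n)) e)
          (relabel-image r ∘ covers)
          (λ (j , j< , eq) → fresh (v≁2 ∘ proj₂) (inj₁ v~0) (to r j , to-< r j< , eq)) v~0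

LongPath : ∀ {n} → Graph n → Set
LongPath {n} G = ∃ λ m → 3 ≤ m × treeGraph id id-decreasing (suc m) ≅ G

-- With the legs sorted, `2 ≤ b` says that at most one leg has length 1, so there are no twin
-- leaves.
GoodSpider : ∀ {n} → Graph n → Set
GoodSpider G = ∃₂ λ a b → ∃ λ c → 0 < a × a ≤ b × b ≤ c × 2 ≤ b ×
  treeGraph (spider a (a + b)) (spider-decreasing (m≤m+n a b)) (suc (a + b + c)) ≅ G

-- With `k` a variable the equation can be matched, which makes `Fin 3` available as index type.
elements : ∀ {n} (X : Subset n) k → ∣ X ∣ ≡ k →
           ∃ λ (h : Fin k → Fin n) → (∀ {i j} → h i ≡ h j → i ≡ j) × (∀ {x} → x ∈ X → ∃ λ i → h i ≡ x)
elements X _ refl = enum X , (λ eq → enum-injective X eq) , enum-surjective X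

minimalTree-shape : ∀ {n} (G : Graph n) → IsTree G → IsMinimal 3 G → LongPath G ⊎ GoodSpider G
minimalTree-shape {n} G (_ , connected , acyclic) (X , ∣X∣≡3 , minimal@(prime , _)) with elements X 3 ∣X∣≡3
... | h , h-injective , h-covers
  with path _≟F_ {Graph._~_ G} (connected (h (suc zero)) (h zero)) (λ eq → case h-injective eq of λ ())
... | m₀ , f₀ , e₀ , f₀0 , f₀m with longPath G prime {m₀} (spanned {f = f₀} e₀ covers₀)
  where
  FirstTwo : Fin n → Set
  FirstTwo x = x ≡ h zero ⊎ x ≡ h (suc zero)
  covers₀ : ∀ {x} → FirstTwo x → Image (suc (suc m₀)) f₀ x
  covers₀ (inj₁ refl) = 0 , s≤s z≤n , f₀0
  covers₀ (inj₂ refl) = suc m₀ , ≤-refl , f₀m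
... | m , 3≤m , spanned {f} e covers = attached (attach _≟F_ e (connected (h (suc (suc zero))) (f 0)) z≤n)
  where
  x∈X⇒ : ∀ {k} {g : ℕ → Fin n} → (∀ {x} → Image (suc m) f x → Image k g x) →
         Image k g (h (suc (suc zero))) → ∀ {x} → x ∈ X → Image k g x
  x∈X⇒ extends third x∈X with h-covers x∈X
  ... | zero , refl           = extends (covers (inj₁ refl))
  ... | suc zero , refl       = extends (covers (inj₂ refl))
  ... | suc (suc zero) , refl = third

  fromPath : ∀ {l} → 3 ≤ l → Spanned G id (suc l) (_∈ X) → LongPath G
  fromPath {l} 3≤l (spanned e covers) = l , 3≤l ,
    minimal⇒≅ id-decreasing G acyclic e (s≤s 3≤l) (path-indecomposable 3≤l) minimal covers

  fromSpider : ∀ {a b c} → 0 < a → a ≤ b → b ≤ c → 2 ≤ b → SpannedSpider G {_∈ X} a b c → GoodSpider G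
  fromSpider {a} {b} {c} 0<a a≤b b≤c 2≤b (spanned e covers) = a , b , c , 0<a , a≤b , b≤c , 2≤b ,
    minimal⇒≅ (spider-decreasing (m≤m+n a b)) G acyclic e (s≤s (≤-trans 3≤ab (m≤m+n (a + b) c)))
      (spider-indecomposable (m≤m+n a b) 3≤ab
        (≤-trans (≤-reflexive (+-comm 2 (a + b))) (+-monoʳ-≤ (a + b) (≤-trans 2≤b b≤c)))) minimal covers
    where
    3≤ab : 3 ≤ a + b
    3≤ab = +-mono-≤ 0<a 2≤b

  fromSorted : ∀ {s} → 4 ≤ s → SortedSpider G {_∈ X} s → GoodSpider G
  fromSorted 4≤s (a , b , c , 0<a , a≤b , b≤c , refl , sp) with 2 ≤? b
  ... | yes 2≤b = fromSpider 0<a a≤b b≤c 2≤b sp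
  ... | no  2≰b with a | b | 0<a | a≤b | ≤-pred (≰⇒> 2≰b)
  -- As `4 ≤ s`, the third leg has length at least 2, so the prolonged legs 1, 2, `c` are still
  -- sorted.
  ...   | 1 | 1 | _ | _ | _ = fromSpider (s≤s z≤n) (s≤s z≤n) (≤-pred (≤-pred 4≤s)) ≤-refl
          (extendTwin G acyclic prime (≤-trans (s≤s z≤n) (≤-pred (≤-pred 4≤s))) sp)
  ...   | suc (suc _) | 1 | _ | s≤s () | _
  ...   | _ | suc (suc _) | _ | _ | s≤s ()
  ...   | 1 | 0 | _ | () | _

  attached : Image (suc m) f (h (suc (suc zero))) ⊎ Attached _≟F_ m f (h (suc (suc zero))) → LongPath G ⊎ GoodSpider G
  attached (inj₁ third) = inj₁ (fromPath 3≤m (spanned e (x∈X⇒ id third)))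
  attached (inj₂ att) = legs (m≤n⇒m<n∨m≡n a≤m) (m≤n⇒m<n∨m≡n (z≤n {a}))
    where
    open Attached att
    all : Spanned G (spider a m) (suc (m + suc c)) (_∈ X)
    all = spanned embeds (x∈X⇒
      (λ (j , j< , eq) → j , ≤-trans j< (s≤s (m≤m+n m (suc c))) , trans (extends (≤-pred j<)) eq)
      (_ , ≤-refl , end))
    long : 3 ≤ m + suc c
    long = ≤-trans 3≤m (m≤m+n m (suc c))
    straight : Spanned G (spider m m) (suc (m + suc c)) (_∈ X) → LongPath G
    straight (spanned e covers) = fromPath long (spanned (spider⇒path G e) covers)
    -- A leg attached at `m` prolongs the path; one attached at 0 does so after a reversal.
    legs : a < m ⊎ a ≡ m → 0 < a ⊎ 0 ≡ a → LongPath G ⊎ GoodSpider G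
    legs (inj₂ refl) _ = inj₁ (straight all)
    legs (inj₁ _) (inj₂ refl) = inj₁ (straight
      (relabelSpanned G (swapFirstLegs z≤n (s≤s (m≤m+n m (suc c)))) (spider-decreasing ≤-refl) all))
    legs (inj₁ a<m) (inj₁ 0<a) = inj₂ (fromSorted
      (≤-trans (≤-trans (s≤s 3≤m) (m<m+n m (s≤s z≤n))) (≤-reflexive (cong (_+ suc c) (sym m≡))))
      (sortLegs G 0<a (m<n⇒0<n∸m a<m) (s≤s z≤n)
        (subst (λ l → Spanned G (spider a l) (suc (l + suc c)) (_∈ X)) (sym m≡) all)))
      where
      m≡ : a + (m ∸ a) ≡ m
      m≡ = m+[n∸m]≡n a≤m

-- Counting

-- The shortest two legs of a spider with s edges; the third one has length
-- s - (a + b) ≥ b.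
Code : ℕ → ℕ × ℕ → Set
Code s (a , b) = 0 < a × a ≤ b × a + b + b ≤ s

-- The number of partitions of s into three parts, by splitting according to
-- whether the smallest part is at least 2.
count : ℕ → ℕ
count (suc (suc (suc s))) = count s + ⌊ suc (suc s) /2⌋
count _ = 0

-- The implicit third leg grows as well, because the total grows by 3.
longer : ℕ × ℕ → ℕ × ℕ
longer (a , b) = suc a , suc b

-- The left block holds the codes with all legs of length at least 2; the right block those with a =
-- 1, where 1 + 2b is at most the total.
decode : ∀ s → Fin (count s) → ℕ × ℕ
decode (suc (suc (suc s))) i = [ longer ∘ decode s , (λ k → 1 , suc (toℕ k)) ]′ (splitAt (count s) i)

k<⌊t/2⌋⇒ : ∀ {k} t → k < ⌊ t /2⌋ → suc k + suc k ≤ t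
k<⌊t/2⌋⇒ {k}     (suc zero)    ()
k<⌊t/2⌋⇒ {zero}  (suc (suc t)) _         = s≤s (s≤s z≤n)
k<⌊t/2⌋⇒ {suc k} (suc (suc t)) (s≤s k<) = s≤s (≤-trans (≤-reflexive (+-suc (suc k) (suc k))) (s≤s (k<⌊t/2⌋⇒ t k<)))

longer-sum : ∀ a b → suc a + suc b + suc b ≡ 3 + (a + b + b)
longer-sum = solve-∀

longer-code : ∀ {s ab} → Code s ab → Code (3 + s) (longer ab)
longer-code {s} {a , b} (0<a , a≤b , ≤s) = s≤s z≤n , s≤s a≤b ,
  ≤-trans (≤-reflexive (longer-sum a b)) (+-monoʳ-≤ 3 ≤s)

longer-code⁻¹ : ∀ {s a b} → 0 < a → Code (3 + s) (longer (a , b)) → Code s (a , b)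
longer-code⁻¹ {s} {a} {b} 0<a (_ , s≤s a≤b , ≤s) = 0<a , a≤b ,
  +-cancelˡ-≤ 3 _ _ (≤-trans (≤-reflexive (sym (longer-sum a b))) ≤s)

decode-code : ∀ s i → Code s (decode s i)
decode-code (suc (suc (suc s))) i with splitAt (count s) i
... | inj₁ j = longer-code (decode-code s j)
... | inj₂ k = s≤s z≤n , s≤s z≤n , s≤s (k<⌊t/2⌋⇒ _ (toℕ<n k))

longer-injective : ∀ {p q} → longer p ≡ longer q → p ≡ q
longer-injective {_ , _} {_ , _} refl = refl

decode-injective : ∀ s {i j} → decode s i ≡ decode s j → i ≡ j
decode-injective (suc (suc (suc s))) {i} {j} eq
  with splitAt (count s) i in eqᵢ | splitAt (count s) j in eqⱼ
... | inj₁ i′ | inj₁ j′ = trans (sym (splitAt⁻¹-↑ˡ eqᵢ)) (trans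
        (cong (_↑ˡ _) (decode-injective s (longer-injective eq))) (splitAt⁻¹-↑ˡ eqⱼ))
... | inj₂ i′ | inj₂ j′ = trans (sym (splitAt⁻¹-↑ʳ eqᵢ)) (trans
        (cong (count s ↑ʳ_) (toℕ-injective (suc-injective (cong proj₂ eq)))) (splitAt⁻¹-↑ʳ eqⱼ))
... | inj₁ i′ | inj₂ j′ = contradiction (sym (suc-injective (cong proj₁ eq))) (<⇒≢ (proj₁ (decode-code s i′)))
... | inj₂ i′ | inj₁ j′ = contradiction (suc-injective (cong proj₁ eq)) (<⇒≢ (proj₁ (decode-code s j′)))

decode-surjective : ∀ s {a b} → Code s (a , b) → ∃ λ i → decode s i ≡ (a , b)
decode-surjective s {zero} (() , _)
decode-surjective 0 {suc a} {suc b} (_ , _ , ())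
decode-surjective 1 {suc a} {suc b} (_ , _ , s≤s ≤s) = contradiction (≤-trans (m≤n+m (suc b) (a + suc b)) ≤s) λ ()
decode-surjective 2 {suc a} {suc b} (_ , _ , s≤s ≤s) =
  contradiction (≤-trans (≤-reflexive (sym (trans (+-suc (a + suc b) b) (cong (λ t → suc (t + b)) (+-suc a b))))) ≤s) λ { (s≤s ()) }
decode-surjective (suc (suc (suc s))) {suc zero} {suc b} (_ , _ , s≤s ≤s) =
  count s ↑ʳ fromℕ< b< , trans (cong [ longer ∘ decode s , (λ k → 1 , suc (toℕ k)) ]′ (splitAt-↑ʳ (count s) _ (fromℕ< b<)))
    (cong (λ k → 1 , suc k) (toℕ-fromℕ< b<))
  where
  b< : b < ⌊ suc (suc s) /2⌋
  b< = ≤-trans (≤-reflexive (n≡⌊n+n/2⌋ (suc b))) (⌊n/2⌋-mono ≤s)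
decode-surjective (suc (suc (suc s))) {suc (suc a)} {suc b} code
  with decode-surjective s (longer-code⁻¹ (s≤s z≤n) code)
... | i , eq = i ↑ˡ _ , trans (cong [ longer ∘ decode s , (λ k → 1 , suc (toℕ k)) ]′ (splitAt-↑ˡ (count s) i _)) (cong longer eq)

-- Rounding s² / 12 means dividing 2 s² + 12 by 24.
count-remainder : ∀ s → ∃ λ r → r < 24 × s * s * 2 + 12 ≡ r + count s * 24
count-remainder 0 = 12 , m≤m+n 13 11 , refl
count-remainder 1 = 14 , m≤m+n 15 9 , refl
count-remainder 2 = 20 , m≤m+n 21 3 , refl
count-remainder 3 = 6 , m≤m+n 7 17 , refl
count-remainder 4 = 20 , m≤m+n 21 3 , refl
count-remainder 5 = 14 , m≤m+n 15 9 , refl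
-- The remainder has period 6: both sides grow by 24 (s + 3), since two steps of the recursion add s
-- + 3 to the count.
count-remainder (suc (suc (suc (suc (suc (suc s)))))) with count-remainder s
... | r , r<24 , eq = r , r<24 , (begin
  (6 + s) * (6 + s) * 2 + 12                  ≡⟨ square s ⟩
  (s * s * 2 + 12) + (s + 3) * 24             ≡⟨ cong₂ (λ x y → x + (y + 3) * 24) eq (sym (⌊n/2⌋+⌈n/2⌉≡n s)) ⟩
  r + count s * 24 + (⌊ s /2⌋ + ⌈ s /2⌉ + 3) * 24 ≡⟨ collect r (count s) ⌊ s /2⌋ ⌈ s /2⌉ ⟩
  r + (count s + suc ⌊ s /2⌋ + suc (suc ⌈ s /2⌉)) * 24 ∎)
  where
  open ≡-Reasoning
  square : ∀ s → (6 + s) * (6 + s) * 2 + 12 ≡ (s * s * 2 + 12) + (s + 3) * 24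
  square = solve-∀
  collect : ∀ r c x y → r + c * 24 + (x + y + 3) * 24 ≡ r + (c + suc x + suc (suc y)) * 24
  collect = solve-∀

-- The closed formula with rounding.

open import Data.Integer using (+_)
import Data.Integer as ℤ
import Data.Integer.DivMod as ℤ
import Data.Integer.Properties as ℤ
import Data.Integer.Tactic.RingSolver as ℤRing
open import Data.Rational.Unnormalised using (_/_; floor; round)

-- Rounding adds one half before taking the floor, and the sum has numerator 2 (x + 1) + 12 over 24.
round-/12 : ∀ x → round (+ suc x / 12) ≡ + ((suc x * 2 + 12) ℕ./ 24)
round-/12 x = ℤ.div-pos-is-/ℕ (+ (suc x * 2 + 12)) 24

floor-/2 : ∀ x → floor (+ x / 2) ≡ + (x ℕ./ 2)
floor-/2 x = ℤ.div-pos-is-/ℕ (+ x) 2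

count-/ : ∀ s → (s * s * 2 + 12) ℕ./ 24 ≡ count s
count-/ s with count-remainder s
... | r , r<24 , eq = begin
  (s * s * 2 + 12) ℕ./ 24        ≡⟨ cong (ℕ._/ 24) eq ⟩
  (r + count s * 24) ℕ./ 24      ≡⟨ +-distrib-/-∣ʳ r (divides (count s) refl) ⟩
  r ℕ./ 24 + count s * 24 ℕ./ 24 ≡⟨ cong₂ _+_ (m<n⇒m/n≡0 r<24) (m*n/n≡m (count s) 24) ⟩
  count s                        ∎
  where open ≡-Reasoning

-- Here `n` counts edges. The arguments of the two floors differ by 1, so the floors cancel against
-- the final - 1 and only the rounded square remains.
count-formula : ∀ {n} → 3 ≤ n →
  + count n ≡ round (((+ suc n ℤ.- + 1) ℤ.^ 2) / 12) ℤ.- floor ((+ suc n ℤ.- + 4) / 2) ℤ.+ floor ((+ suc n ℤ.- + 2) / 2) ℤ.- + 1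
count-formula {zero} ()
count-formula {suc zero} (s≤s ())
count-formula {suc (suc zero)} (s≤s (s≤s ()))
count-formula {s@(suc (suc (suc t)))} _ = sym (begin
  round (((+ s) ℤ.^ 2) / 12) ℤ.- floor (+ t / 2) ℤ.+ floor (+ suc (suc t) / 2) ℤ.- + 1
    ≡⟨ cong (λ x → round (x / 12) ℤ.- floor (+ t / 2) ℤ.+ floor (+ suc (suc t) / 2) ℤ.- + 1)
         (cong (+ s ℤ.*_) (ℤ.*-identityʳ (+ s))) ⟩
  round (+ (s * s) / 12) ℤ.- floor (+ t / 2) ℤ.+ floor (+ suc (suc t) / 2) ℤ.- + 1
    ≡⟨ cong₂ (λ x y → x ℤ.- y ℤ.+ floor (+ suc (suc t) / 2) ℤ.- + 1)
         (trans (round-/12 (suc (suc t) + suc (suc t) * s)) (cong +_ (count-/ s))) (floor-/2 t) ⟩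
  + count s ℤ.- h ℤ.+ floor (+ suc (suc t) / 2) ℤ.- + 1
    ≡⟨ cong (λ x → + count s ℤ.- h ℤ.+ x ℤ.- + 1)
         (trans (floor-/2 (suc (suc t))) (cong +_ (m/n≡1+[m∸n]/n {suc (suc t)} (s≤s (s≤s z≤n))))) ⟩
  + count s ℤ.- h ℤ.+ (+ 1 ℤ.+ h) ℤ.- + 1
    ≡⟨ cancel (+ count s) h ⟩
  + count s ∎)
  where
  open ≡-Reasoning
  h : ℤ.ℤ
  h = + (t ℕ./ 2)
  cancel : ∀ x y → x ℤ.- y ℤ.+ (+ 1 ℤ.+ y) ℤ.- + 1 ≡ x
  cancel = ℤRing.solve-∀

-- Classification of the 3-minimal trees.

pathGraph : ∀ n → Graph n
pathGraph = treeGraph id id-decreasing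

spiderGraph : ℕ → ℕ → ∀ n → Graph n
spiderGraph a b = treeGraph (spider a (a + b)) (spider-decreasing (m≤m+n a b))

-- The only non-prime spiders among the codes have legs 1, 1, s - 2; their
-- codes are used for the path instead.
graphOf : ∀ s → ℕ × ℕ → Graph (suc s)
graphOf s (a , b) with b ≟ 1
... | yes _ = pathGraph (suc s)
... | no  _ = spiderGraph a b (suc s)

module _ {s a b : ℕ} (code : Code s (a , b)) where

  code-0<a : 0 < a
  code-0<a = proj₁ code

  code-a≤b : a ≤ b
  code-a≤b = proj₁ (proj₂ code)

  code-≤s : a + b + b ≤ s
  code-≤s = proj₂ (proj₂ code)

  code-2≤b : b ≢ 1 → 2 ≤ b
  code-2≤b b≢1 = ≤∧≢⇒< (≤-trans code-0<a code-a≤b) (b≢1 ∘ sym)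

  code-a<m : a < a + b
  code-a<m = m<m+n a (≤-trans code-0<a code-a≤b)

  code-m<s : a + b < s
  code-m<s = ≤-trans (m<m+n (a + b) (≤-trans code-0<a code-a≤b)) code-≤s

graphOf-minimalTree : ∀ {s ab} → 3 ≤ s → Code s ab → IsTree (graphOf s ab) × IsMinimal 3 (graphOf s ab)
graphOf-minimalTree {s} {a , b} 3≤s code with b ≟ 1
... | yes _   = treeGraph-isTree id-decreasing s , path-minimal 3≤s
... | no  b≢1 = treeGraph-isTree (spider-decreasing (m≤m+n a b)) s , spider-minimal (m≤m+n a b)
  (+-mono-≤ (code-0<a code) (code-2≤b code b≢1))
  (≤-trans (≤-reflexive (+-comm 2 (a + b))) (≤-trans (+-monoʳ-≤ (a + b) (code-2≤b code b≢1)) (code-≤s code)))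

pathGraph-notBranching : ∀ {s x} → ¬ Branching (pathGraph (suc s)) x
pathGraph-notBranching {s} = notBranching id-decreasing s λ _ → id

module _ {s a b a′ b′ : ℕ} (code : Code s (a , b)) (code′ : Code s (a′ , b′))
         (iso : spiderGraph a b (suc s) ≅ spiderGraph a′ b′ (suc s)) where

  private
    lengths : ∀ {ℓ} → Leg (spiderGraph a b (suc s)) ℓ → ℓ ≡ a′ ⊎ a′ + ℓ ≡ a′ + b′ ⊎ a′ + b′ + ℓ ≡ s
    lengths leg = leg-lengths (code-0<a code′) (code-a<m code′) (code-m<s code′)
      (leg-≅ {G = spiderGraph a b (suc s)} {spiderGraph a′ b′ (suc s)} iso leg)

  -- The first leg is carried to some leg of the other spider, and all legs there have length at
  -- least `a′`.
  shortest-≤ : a′ ≤ a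
  shortest-≤ with lengths (innerLeg (code-0<a code) (code-a<m code) (code-m<s code))
  ... | inj₁ eq        = ≤-reflexive (sym eq)
  ... | inj₂ (inj₁ eq) = ≤-trans (code-a≤b code′) (≤-reflexive (sym (+-cancelˡ-≡ a′ _ _ eq)))
  ... | inj₂ (inj₂ eq) = ≤-trans (code-a≤b code′) (+-cancelˡ-≤ (a′ + b′) _ _ (≤-trans (code-≤s code′) (≤-reflexive (sym eq))))

  -- Likewise the third leg is at most as long as the longest leg of the other spider; complements
  -- in `s` reverse the inequality.
  longest-≥ : a′ + b′ ≤ a + b
  longest-≥ = +-cancelʳ-≤ c (a′ + b′) (a + b) (≤-trans fits (≤-reflexive (sym m+c)))
    where
    c : ℕ
    c = s ∸ (a + b)
    m+c : a + b + c ≡ s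
    m+c = m+[n∸m]≡n (<⇒≤ (code-m<s code))
    fits : a′ + b′ + c ≤ s
    fits with lengths (outerLeg (code-0<a code) (code-a<m code) (code-m<s code) m+c)
    ... | inj₁ eq        = ≤-trans (+-monoʳ-≤ (a′ + b′) (≤-trans (≤-reflexive eq) (code-a≤b code′))) (code-≤s code′)
    ... | inj₂ (inj₁ eq) = ≤-trans (+-monoʳ-≤ (a′ + b′) (≤-reflexive (+-cancelˡ-≡ a′ _ _ eq))) (code-≤s code′)
    ... | inj₂ (inj₂ eq) = ≤-reflexive eq

-- A path has no branching vertex, which tells it from the spiders. For two spiders the inequalities
-- above hold in both directions.
graphOf-injective : ∀ {s ab ab′} → Code s ab → Code s ab′ → graphOf s ab ≅ graphOf s ab′ → ab ≡ ab′
graphOf-injective {s} {a , b} {a′ , b′} code code′ iso with b ≟ 1 | b′ ≟ 1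
... | yes refl | yes refl = cong (_, 1) (trans (a≡1 code) (sym (a≡1 code′)))
  where
  a≡1 : ∀ {a} → Code s (a , 1) → a ≡ 1
  a≡1 code = ≤-antisym (code-a≤b code) (code-0<a code)
... | yes _ | no _ = contradiction
  (branching-≅ {G = spiderGraph a′ b′ (suc s)} {pathGraph (suc s)} (≅-sym {G = pathGraph (suc s)} {spiderGraph a′ b′ (suc s)} iso)
    (centre-branching (code-0<a code′) (code-a<m code′) (code-m<s code′)))
  pathGraph-notBranching
... | no _ | yes _ = contradiction
  (branching-≅ {G = spiderGraph a b (suc s)} {pathGraph (suc s)} iso
    (centre-branching (code-0<a code) (code-a<m code) (code-m<s code)))
  pathGraph-notBranching
... | no _ | no _ = cong₂ _,_ a≡a′ (+-cancelˡ-≡ a b b′ (trans m≡m′ (cong (_+ b′) (sym a≡a′))))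
  where
  iso⁻¹ : spiderGraph a′ b′ (suc s) ≅ spiderGraph a b (suc s)
  iso⁻¹ = ≅-sym {G = spiderGraph a b (suc s)} {spiderGraph a′ b′ (suc s)} iso
  a≡a′ : a ≡ a′
  a≡a′ = ≤-antisym (shortest-≤ code′ code iso⁻¹) (shortest-≤ code code′ iso)
  m≡m′ : a + b ≡ a′ + b′
  m≡m′ = ≤-antisym (longest-≥ code′ code iso⁻¹) (longest-≥ code code′ iso)

graphOf-surjective : ∀ {s} → 3 ≤ s → (G : Graph (suc s)) → IsTree G → IsMinimal 3 G →
                     ∃ λ ab → Code s ab × graphOf s ab ≅ G
graphOf-surjective {s} 3≤s G tree minimal with minimalTree-shape G tree minimal
... | inj₁ (m , _ , iso) with suc-injective (↔⇒≡ (proj₁ iso))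
...   | refl = (1 , 1) , (s≤s z≤n , s≤s z≤n , 3≤s) , iso
graphOf-surjective {s} 3≤s G tree minimal
    | inj₂ (a , b , c , 0<a , a≤b , b≤c , 2≤b , iso) with suc-injective (↔⇒≡ (proj₁ iso))
...   | refl = (a , b) , (0<a , a≤b , +-monoʳ-≤ (a + b) b≤c) , iso′
  where
  iso′ : graphOf (a + b + c) (a , b) ≅ G
  iso′ with b ≟ 1
  ... | yes refl = contradiction 2≤b λ { (s≤s ()) }
  ... | no  _    = iso

classification : ∀ {s} → 3 ≤ s → HasClasses (minimalTrees 3 (suc s)) (count s)
classification {s} 3≤s = record
  { to        = tree
  ; cong      = λ { {i} refl → ≅-refl {G = proj₁ (tree i)} }
  ; bijective =
      (λ iso → decode-injective s (graphOf-injective (decode-code s _) (decode-code s _) iso)) ,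
      surjective
  }
  where
  tree : Fin (count s) → Σ (Graph (suc s)) λ G → IsTree G × IsMinimal 3 G
  tree i = graphOf s (decode s i) , graphOf-minimalTree 3≤s (decode-code s i)
  surjective : ∀ y → ∃ λ i → ∀ {j} → j ≡ i → proj₁ (tree j) ≅ proj₁ y
  surjective (G , G-tree , minimal) with graphOf-surjective 3≤s G G-tree minimal
  ... | ab , code , iso with decode-surjective s code
  ...   | i , eq = i , λ { refl → subst (λ ab → graphOf s ab ≅ G) (sym eq) iso }

proposition3p3 : (n : ℕ) → 4 ≤ n →
    ∃ λ (N : ℕ) → HasClasses (minimalTrees 3 n) N
    × (n ≡ 4 ⊎ n ≡ 5 → N ≡ 1)
    × (n ≡ 6 → N ≡ 2)
    × (7 ≤ n → + N ≡ round (((+ n ℤ.- + 1) ℤ.^ 2) / 12) ℤ.- floor ((+ n ℤ.- + 4) / 2) ℤ.+ floor ((+ n ℤ.- + 2) / 2) ℤ.- + 1)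
proposition3p3 (suc s) (s≤s 3≤s) = count s , classification 3≤s ,
  -- By computation, `count` takes the values 1, 1, 2 at 3, 4, 5 edges.
  (λ { (inj₁ refl) → refl ; (inj₂ refl) → refl }) , (λ { refl → refl }) , λ _ → count-formula 3≤s
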